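{- Let $k$ be a non-negative integer. For $|q|<1$, and for either choice of sign (upper signs throughout, or lower signs throughout), \begin{enumerate} \item[(i)] $\displaystyle \sum_{j=k}^\infty (\mp 1)^{j-k} \binom{2j}{j-k} V^{\pm}_{j}(q) = \frac{(\pm q;q)^2_\infty}{(q;q)^2_\infty} \left(-1+(1+q^k) \sum_{j=k}^\infty (-1)^{j-k}\,q^{j(j+1)/2-k(k+1)/2}\right)$; \item[(ii)] $\displaystyle \sum_{j=k}^\infty (\mp 1)^{j-k} \binom{2j}{j-k} W^{\pm}_{j}(q) = \frac{(\pm q;q^2)^2_\infty}{(q^2;q^2)^2_\infty}\sum_{j=k}^\infty (-1)^{j-k}\,q^{j(j+1)-k^2}$. \end{enumerate}
   Context: For $n\ge0$, $(a;q)_n=\prod_{r=0}^{n-1}(1-aq^r)$, and $(a;q)_\infty=\lim_{n\to\infty}(a;q)_n$ for $|q|<1$. For a non-negative integer $k$ define $$V^{\pm}_{k}(q)=\sum_{1\le n_1\le n_2\le\cdots\le n_k}\prod_{i=1}^k\frac{q^{n_i}}{(1\mp q^{n_i})^2},\qquad W^{\pm}_{k}(q)=\sum_{1\le n_1\le n_2\le\cdots\le n_k}\prod_{i=1}^k\frac{q^{2n_i-1}}{(1\mp q^{2n_i-1})^2},$$ with $V^{\pm}_0(q)=W^{\pm}_0(q)=1$.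
   Formalization: The identities are proved as identities of formal power series in q, not for each |q|<1: the left-hand series diverge for some |q|<1 (e.g. q=1/2, upper sign); where they converge, such as small |q|, the numerical identities follow. -}

module Defs where

-- Formal power series in q with integer coefficients, and the objects of the
-- paper as formal power series (identities for |q|<1 are identities of the
-- coefficients of the Taylor expansions at q = 0).

open import Data.Nat as ℕ using (ℕ; zero; suc; _∸_; _≡ᵇ_)
open import Data.Integer as ℤ using (ℤ; +_; -[1+_])
open import Data.Sign using (Sign)
open import Data.Bool using (if_then_else_)
open import Data.Nat.Combinatorics using (_C_)

-- A formal power series: n ↦ coefficient of q^n.
PS : Set
PS = ℕ → ℤ

sumUpTo : ℕ → (ℕ → ℤ) → ℤ
sumUpTo zero f = f zero
sumUpTo (suc n) f = sumUpTo n f ℤ.+ f (suc n)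

sgn : Sign → ℤ
sgn Sign.+ = + 1
sgn Sign.- = ℤ.- (+ 1)

const : ℤ → PS
const c zero = c
const c (suc _) = + 0

0ₚ 1ₚ : PS
0ₚ = const (+ 0)
1ₚ = const (+ 1)

X^ : ℕ → PS
X^ e n = if n ≡ᵇ e then + 1 else + 0

infixl 6 _+ₚ_ _-ₚ_
infixl 7 _*ₚ_
infixr 8 _^ₚ_

_+ₚ_ : PS → PS → PS
(a +ₚ b) n = a n ℤ.+ b n

_-ₚ_ : PS → PS → PS
(a -ₚ b) n = a n ℤ.- b n

scale : ℤ → PS → PS
scale c a n = c ℤ.* a n

_*ₚ_ : PS → PS → PS
(a *ₚ b) n = sumUpTo n (λ i → a i ℤ.* b (n ∸ i))

_^ₚ_ : PS → ℕ → PS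
a ^ₚ zero = 1ₚ
a ^ₚ suc m = a *ₚ (a ^ₚ m)

-- 1/(1-u) = Σ_m u^m, for u with zero constant term (only m ≤ n contributes
-- to the coefficient of q^n).
inv1m : PS → PS
inv1m u n = sumUpTo n (λ m → (u ^ₚ m) n)

-- multiplicative inverse of a series with constant term 1
recip : PS → PS
recip a = inv1m (1ₚ -ₚ a)

-- q-adic sum Σ_{i≥0} F i of a family with ord(F i) ≥ i
-- (only i ≤ n contributes to the coefficient of q^n).
qsum : (ℕ → PS) → PS
qsum F n = sumUpTo n (λ i → F i n)

poch : PS → PS → ℕ → PS
poch a b zero = 1ₚ
poch a b (suc m) = poch a b m *ₚ (1ₚ -ₚ a *ₚ b ^ₚ m)

-- (a;b)_∞ for a, b with zero constant term: factors with r > n are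
-- ≡ 1 mod q^(n+1), so coefficient n is that of (a;b)_(n+1).
pochInf : PS → PS → PS
pochInf a b n = poch a b (suc n) n

-- chain sums: chainSum f k m = Σ_{1 ≤ n_1 ≤ ... ≤ n_k ≤ m} Π f(n_i)
chainSum : (ℕ → PS) → ℕ → ℕ → PS
chainSum f zero m = 1ₚ
chainSum f (suc k) zero = 0ₚ
chainSum f (suc k) (suc m) = chainSum f (suc k) m +ₚ f (suc m) *ₚ chainSum f k (suc m)

-- Σ_{1 ≤ n_1 ≤ ... ≤ n_k} Π f(n_i), for f(n) of order ≥ 1 (terms with
-- n_k > N do not contribute to the coefficient of q^N).
chainSumInf : (ℕ → PS) → ℕ → PS
chainSumInf f k N = chainSum f k N N

X : PS
X = X^ 1

-- V^±_k and W^±_k, with ε = +1 for the upper sign, -1 for the lower sign.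
Vterm : ℤ → ℕ → PS
Vterm ε n = X^ n *ₚ recip ((1ₚ -ₚ scale ε (X^ n)) ^ₚ 2)

Wterm : ℤ → ℕ → PS
Wterm ε n = X^ (2 ℕ.* n ∸ 1) *ₚ recip ((1ₚ -ₚ scale ε (X^ (2 ℕ.* n ∸ 1))) ^ₚ 2)

V : Sign → ℕ → PS
V s k = chainSumInf (Vterm (sgn s)) k

W : Sign → ℕ → PS
W s k = chainSumInf (Wterm (sgn s)) k

{-# OPTIONS --safe #-}
module Submission where

-- Write y_i for q^(i+1) (case V) or q^(2i+1) (case W).  With x = z + 1/z - 2ε the
-- generating function Σ_j x^j Σ_{n_1 ≤ ... ≤ n_j ≤ m} Π y/(1-εy)² equals
-- Π_{i<m} (1-εy_i)² / ((1-z y_i)(1-y_i/z)), and the coefficient of z^k in x^j is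
-- (-ε)^(j-k) C(2j,j-k).  So the left-hand sides are the coefficients of z^k of
-- this product for m = ∞.  For finite m the product has an explicit partial
-- fraction expansion in z.  Both descriptions satisfy the recurrence obtained by
-- clearing the last factor, and that recurrence determines its solution modulo
-- every power of q; the theorem is the limit m → ∞.

open import Defs
open import Data.Nat as ℕ using (ℕ; zero; suc; _∸_; _/_; z≤n; s≤s)
import Data.Nat.Properties as ℕₚ
open import Data.Nat.Combinatorics using (_C_; nCk≡nC[n∸k]; nCk+nC[k+1]≡[n+1]C[k+1])
import Data.Nat.DivMod as DivMod
import Data.Nat.Solver as NatSolver
open import Data.Integer as ℤ using (ℤ; +_)
import Data.Integer.Properties as ℤₚ
open import Data.Integer.Solver using (module +-*-Solver)
open import Data.Sign using (Sign)
open import Data.Maybe.Base using (map)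
open import Data.Product using (_×_; _,_)
open import Function using (_∘_)
open import Level using (0ℓ)
open import Algebra.Bundles using (CommutativeRing)
open import Algebra.Structures using (IsCommutativeRing)
open import Algebra.Solver.Ring.AlmostCommutativeRing using (_-Raw-AlmostCommutative⟶_; fromCommutativeRing)
import Algebra.Solver.Ring as RingSolver
import Algebra.Properties.Semiring.Exp as Exp
open import Relation.Nullary using (yes; no)
open import Relation.Nullary.Decidable using (dec⇒maybe)
open import Relation.Binary.PropositionalEquality using (_≡_; refl; sym; trans; cong; cong₂; subst; module ≡-Reasoning)
import Relation.Binary.Reasoning.Setoid as SetoidReasoning

-- The code has no variable `z`: by the symmetry under `z → 1/z` only coefficients with `k ≥ 0` are
-- kept, and `z + 1/z` acts on them through `neighbours`. The price is paid at `k = 0`, where the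
-- neighbours are two copies of coefficient 1, while the partial fraction terms `y_i^k` would
-- suggest `y_i` and `1/y_i`. That both agree after summation is a hypergeometric identity, the only
-- part of the recurrence that does not hold term by term. Both recurrences rest on `(1 - zy)(1 -
-- y/z) = (1 - εy)² - y(z + 1/z - 2ε)`, which needs `ε² = 1`. Denominators stay cleared, so that
-- only series with constant term 1 are ever cancelled. The two families share the form
-- `y_i = p^i q` with `q² = p^b`: `p = q`, `b = 2` for V, and `p = q²`, `b = 1` for W. In the limit
-- `b` is felt only through `w i = (p;p)_(i+b-1)/(p;p)_i`, which is `1 - q^(i+1)` for V and `1` for
-- W. The former telescopes to the shape `-1 + (1 + q^k) Σ`.

-- Laurent coefficients and binomial coefficients

-- Coefficient of z^k in (z + 1/z - 2ε)^j.
centralCoeff : ℤ → ℕ → ℕ → ℤ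
centralCoeff ε zero    zero    = + 1
centralCoeff ε (suc k) zero    = + 0
centralCoeff ε zero    (suc j) = centralCoeff ε 1 j ℤ.+ centralCoeff ε 1 j ℤ.- (ε ℤ.+ ε) ℤ.* centralCoeff ε 0 j
centralCoeff ε (suc k) (suc j) = centralCoeff ε k j ℤ.+ centralCoeff ε (2 ℕ.+ k) j ℤ.- (ε ℤ.+ ε) ℤ.* centralCoeff ε (suc k) j

pascal : ∀ n k → + (suc n C suc k) ≡ + (n C k) ℤ.+ + (n C suc k)
pascal n k = trans (cong +_ (sym (nCk+nC[k+1]≡[n+1]C[k+1] n k))) (ℤₚ.pos-+ (n C k) (n C suc k))

pascal² : ∀ n k → + ((2 ℕ.+ n) C (2 ℕ.+ k)) ≡ + (n C k) ℤ.+ + (n C suc k) ℤ.+ (+ (n C suc k) ℤ.+ + (n C (2 ℕ.+ k)))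
pascal² n k = trans (pascal (suc n) (suc k)) (cong₂ ℤ._+_ (pascal n k) (pascal n (suc k)))

C-symmetric : ∀ j → (2 ℕ.* suc j) C j ≡ (2 ℕ.* suc j) C (2 ℕ.+ j)
C-symmetric j = trans (nCk≡nC[n∸k] (ℕₚ.≤-trans (ℕₚ.n≤1+n j) (ℕₚ.m≤m+n (suc j) _)))
  (cong ((2 ℕ.* suc j) C_) (begin
    2 ℕ.* suc j ∸ j           ≡⟨ cong (_∸ j) (cong suc (trans (ℕₚ.+-suc j (j ℕ.+ 0)) (cong suc (cong (j ℕ.+_) (ℕₚ.+-identityʳ j))))) ⟩
    2 ℕ.+ (j ℕ.+ j) ∸ j       ≡⟨ cong (_∸ j) (sym (ℕₚ.+-assoc 2 j j)) ⟩
    2 ℕ.+ j ℕ.+ j ∸ j         ≡⟨ ℕₚ.m+n∸n≡m (2 ℕ.+ j) j ⟩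
    2 ℕ.+ j ∎))
  where open ≡-Reasoning

centralCoeff-< : ∀ ε k j → j ℕ.< k → centralCoeff ε k j ≡ + 0
centralCoeff-< ε (suc k) zero    _ = refl
centralCoeff-< ε (suc k) (suc j) (s≤s j<k)
  rewrite centralCoeff-< ε k j j<k
        | centralCoeff-< ε (suc k) j (ℕₚ.m<n⇒m<1+n j<k)
        | centralCoeff-< ε (2 ℕ.+ k) j (ℕₚ.m<n⇒m<1+n (ℕₚ.m<n⇒m<1+n j<k)) =
  solve 1 (λ e → con (+ 0) :+ con (+ 0) :- (e :+ e) :* con (+ 0) := con (+ 0)) refl ε
  where open +-*-Solver

module _ (ε : ℤ) (ε² : ε ℤ.* ε ≡ + 1) where

  private
    η : ℕ → ℤ
    η i = (ℤ.- ε) ℤ.^ i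

    η² : ∀ i → η (2 ℕ.+ i) ≡ η i
    η² i = begin
      (ℤ.- ε) ℤ.* ((ℤ.- ε) ℤ.* η i)   ≡⟨ solve 2 (λ e x → (:- e) :* ((:- e) :* x) := (e :* e) :* x) refl ε (η i) ⟩
      ε ℤ.* ε ℤ.* η i                 ≡⟨ cong (ℤ._* η i) ε² ⟩
      + 1 ℤ.* η i                     ≡⟨ ℤₚ.*-identityˡ (η i) ⟩
      η i ∎
      where
      open +-*-Solver
      open ≡-Reasoning

  -- For `ε² = 1` the base is `(z - ε)²/z`, so this is the binomial theorem. The induction matches
  -- the three-term recursion with two Pascal steps: `η²` gives the outer terms equal signs, and
  -- `-2ε` supplies the sign of the middle one. The separate `i`, tied to `j` by an equation, avoids
  -- subtraction and keeps the recursion structural in `j`.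
  centralCoeff≡C′ : ∀ j k i → k ℕ.+ i ≡ j → centralCoeff ε k j ≡ η i ℤ.* + ((2 ℕ.* j) C i)
  centralCoeff≡C′ zero zero zero _ = refl
  centralCoeff≡C′ (suc zero) zero .1 refl =
    solve 1 (λ e → con (+ 0) :+ con (+ 0) :- (e :+ e) :* con (+ 1) := (:- e) :* con (+ 1) :* con (+ 2)) refl ε
    where open +-*-Solver
  centralCoeff≡C′ (suc (suc j)) zero .(2 ℕ.+ j) refl = begin
    centralCoeff ε 1 (suc j) ℤ.+ centralCoeff ε 1 (suc j) ℤ.- (ε ℤ.+ ε) ℤ.* centralCoeff ε 0 (suc j)
      ≡⟨ cong₂ (λ x y → x ℤ.+ x ℤ.- (ε ℤ.+ ε) ℤ.* y) (centralCoeff≡C′ (suc j) 1 j refl) (centralCoeff≡C′ (suc j) 0 (suc j) refl) ⟩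
    η j ℤ.* c₀ ℤ.+ η j ℤ.* c₀ ℤ.- (ε ℤ.+ ε) ℤ.* ((ℤ.- ε) ℤ.* η j ℤ.* c₁)
      ≡⟨ cong (λ z → z ℤ.* c₀ ℤ.+ z ℤ.* c₀ ℤ.- (ε ℤ.+ ε) ℤ.* ((ℤ.- ε) ℤ.* η j ℤ.* c₁)) (sym (η² j)) ⟩
    η (2 ℕ.+ j) ℤ.* c₀ ℤ.+ η (2 ℕ.+ j) ℤ.* c₀ ℤ.- (ε ℤ.+ ε) ℤ.* ((ℤ.- ε) ℤ.* η j ℤ.* c₁)
      ≡⟨ solve 4 (λ e n c d → (:- e) :* ((:- e) :* n) :* c :+ (:- e) :* ((:- e) :* n) :* c :- (e :+ e) :* ((:- e) :* n :* d)
           := (:- e) :* ((:- e) :* n) :* (c :+ d :+ (d :+ c))) refl ε (η j) c₀ c₁ ⟩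
    η (2 ℕ.+ j) ℤ.* (c₀ ℤ.+ c₁ ℤ.+ (c₁ ℤ.+ c₀))
      -- The coefficients at 1 and -1 coincide; reflection turns one of the two copies into the
      -- third binomial coefficient of the double Pascal rule.
      ≡⟨ cong (λ z → η (2 ℕ.+ j) ℤ.* (c₀ ℤ.+ c₁ ℤ.+ (c₁ ℤ.+ + z))) (C-symmetric j) ⟩
    η (2 ℕ.+ j) ℤ.* (c₀ ℤ.+ c₁ ℤ.+ (c₁ ℤ.+ + ((2 ℕ.* suc j) C (2 ℕ.+ j))))
      ≡⟨ cong (η (2 ℕ.+ j) ℤ.*_) (sym (pascal² (2 ℕ.* suc j) j)) ⟩
    η (2 ℕ.+ j) ℤ.* + ((2 ℕ.+ 2 ℕ.* suc j) C (2 ℕ.+ j))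
      ≡⟨ cong (λ z → η (2 ℕ.+ j) ℤ.* + (z C (2 ℕ.+ j))) (sym (ℕₚ.*-suc 2 (suc j))) ⟩
    η (2 ℕ.+ j) ℤ.* + ((2 ℕ.* (2 ℕ.+ j)) C (2 ℕ.+ j)) ∎
    where
    open +-*-Solver
    open ≡-Reasoning
    c₀ = + ((2 ℕ.* suc j) C j)
    c₁ = + ((2 ℕ.* suc j) C suc j)
  centralCoeff≡C′ (suc j) (suc k) zero eq
    rewrite centralCoeff≡C′ j k 0 (ℕₚ.suc-injective eq)
          | centralCoeff-< ε (suc k) j (s≤s (ℕₚ.≤-reflexive (sym (trans (sym (ℕₚ.+-identityʳ k)) (ℕₚ.suc-injective eq)))))
          | centralCoeff-< ε (2 ℕ.+ k) j (s≤s (ℕₚ.m≤n⇒m≤1+n (ℕₚ.≤-reflexive (sym (trans (sym (ℕₚ.+-identityʳ k)) (ℕₚ.suc-injective eq)))))) =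
    solve 1 (λ e → con (+ 1) :+ con (+ 0) :- (e :+ e) :* con (+ 0) := con (+ 1)) refl ε
    where open +-*-Solver
  centralCoeff≡C′ (suc j) (suc k) (suc zero) eq = begin
    centralCoeff ε k j ℤ.+ centralCoeff ε (2 ℕ.+ k) j ℤ.- (ε ℤ.+ ε) ℤ.* centralCoeff ε (suc k) j
      ≡⟨ cong₂ (λ x y → x ℤ.+ centralCoeff ε (2 ℕ.+ k) j ℤ.- (ε ℤ.+ ε) ℤ.* y)
           (centralCoeff≡C′ j k 1 eq′) (centralCoeff≡C′ j (suc k) 0 (trans (sym (ℕₚ.+-suc k 0)) eq′)) ⟩
    η 1 ℤ.* c₁ ℤ.+ centralCoeff ε (2 ℕ.+ k) j ℤ.- (ε ℤ.+ ε) ℤ.* + 1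
      ≡⟨ cong (λ x → η 1 ℤ.* c₁ ℤ.+ x ℤ.- (ε ℤ.+ ε) ℤ.* + 1)
           (centralCoeff-< ε (2 ℕ.+ k) j (s≤s (ℕₚ.≤-reflexive (sym (trans (sym (trans (ℕₚ.+-suc k 0) (cong suc (ℕₚ.+-identityʳ k)))) eq′))))) ⟩
    η 1 ℤ.* c₁ ℤ.+ + 0 ℤ.- (ε ℤ.+ ε) ℤ.* + 1
      ≡⟨ solve 2 (λ e c → (:- e) :* con (+ 1) :* c :+ con (+ 0) :- (e :+ e) :* con (+ 1)
           := (:- e) :* con (+ 1) :* (con (+ 1) :+ (con (+ 1) :+ c))) refl ε c₁ ⟩
    η 1 ℤ.* (+ 1 ℤ.+ (+ 1 ℤ.+ c₁))
      ≡⟨ cong (λ z → η 1 ℤ.* (+ 1 ℤ.+ z)) (sym (pascal (2 ℕ.* j) 0)) ⟩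
    η 1 ℤ.* (+ 1 ℤ.+ + ((1 ℕ.+ 2 ℕ.* j) C 1))
      ≡⟨ cong (η 1 ℤ.*_) (sym (pascal (1 ℕ.+ 2 ℕ.* j) 0)) ⟩
    η 1 ℤ.* + ((2 ℕ.+ 2 ℕ.* j) C 1)
      ≡⟨ cong (λ z → η 1 ℤ.* + (z C 1)) (sym (ℕₚ.*-suc 2 j)) ⟩
    η 1 ℤ.* + ((2 ℕ.* suc j) C 1) ∎
    where
    open +-*-Solver
    open ≡-Reasoning
    c₁ = + ((2 ℕ.* j) C 1)
    eq′ : k ℕ.+ 1 ≡ j
    eq′ = ℕₚ.suc-injective eq
  centralCoeff≡C′ (suc j) (suc k) (suc (suc i)) eq = begin
    centralCoeff ε k j ℤ.+ centralCoeff ε (2 ℕ.+ k) j ℤ.- (ε ℤ.+ ε) ℤ.* centralCoeff ε (suc k) j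
      ≡⟨ cong₂ (λ x y → x ℤ.+ centralCoeff ε (2 ℕ.+ k) j ℤ.- (ε ℤ.+ ε) ℤ.* y)
           (centralCoeff≡C′ j k (2 ℕ.+ i) eq₀) (centralCoeff≡C′ j (suc k) (suc i) eq₁) ⟩
    η (2 ℕ.+ i) ℤ.* c₂ ℤ.+ centralCoeff ε (2 ℕ.+ k) j ℤ.- (ε ℤ.+ ε) ℤ.* (η (suc i) ℤ.* c₁)
      ≡⟨ cong (λ x → η (2 ℕ.+ i) ℤ.* c₂ ℤ.+ x ℤ.- (ε ℤ.+ ε) ℤ.* (η (suc i) ℤ.* c₁))
           (trans (centralCoeff≡C′ j (2 ℕ.+ k) i eq₂) (cong (ℤ._* c₀) (sym (η² i)))) ⟩
    η (2 ℕ.+ i) ℤ.* c₂ ℤ.+ η (2 ℕ.+ i) ℤ.* c₀ ℤ.- (ε ℤ.+ ε) ℤ.* (η (suc i) ℤ.* c₁)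
      ≡⟨ solve 5 (λ e n a b c → (:- e) :* ((:- e) :* n) :* c :+ (:- e) :* ((:- e) :* n) :* a :- (e :+ e) :* ((:- e) :* n :* b)
           := (:- e) :* ((:- e) :* n) :* (a :+ b :+ (b :+ c))) refl ε (η i) c₀ c₁ c₂ ⟩
    η (2 ℕ.+ i) ℤ.* (c₀ ℤ.+ c₁ ℤ.+ (c₁ ℤ.+ c₂))
      ≡⟨ cong (η (2 ℕ.+ i) ℤ.*_) (sym (pascal² (2 ℕ.* j) i)) ⟩
    η (2 ℕ.+ i) ℤ.* + ((2 ℕ.+ 2 ℕ.* j) C (2 ℕ.+ i))
      ≡⟨ cong (λ z → η (2 ℕ.+ i) ℤ.* + (z C (2 ℕ.+ i))) (sym (ℕₚ.*-suc 2 j)) ⟩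
    η (2 ℕ.+ i) ℤ.* + ((2 ℕ.* suc j) C (2 ℕ.+ i)) ∎
    where
    open +-*-Solver
    open ≡-Reasoning
    c₀ = + ((2 ℕ.* j) C i)
    c₁ = + ((2 ℕ.* j) C suc i)
    c₂ = + ((2 ℕ.* j) C (2 ℕ.+ i))
    eq₀ : k ℕ.+ (2 ℕ.+ i) ≡ j
    eq₀ = ℕₚ.suc-injective eq
    eq₁ : suc k ℕ.+ suc i ≡ j
    eq₁ = trans (sym (ℕₚ.+-suc k (suc i))) eq₀
    eq₂ : 2 ℕ.+ k ℕ.+ i ≡ j
    eq₂ = trans (sym (cong suc (ℕₚ.+-suc k i))) eq₁

  centralCoeff≡C : ∀ k i → centralCoeff ε k (k ℕ.+ i) ≡ (ℤ.- ε) ℤ.^ i ℤ.* + ((2 ℕ.* (k ℕ.+ i)) C i)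
  centralCoeff≡C k i = centralCoeff≡C′ (k ℕ.+ i) k i refl

-- Finite sums and Laurent coefficients over an abstract ring

-- Abstract so that the product of series does not unfold during unification.
record IntegerAlgebra : Set₁ where
  infix  4 _≈_
  infixl 6 _+_
  infixl 7 _*_
  infix  8 -_
  field
    Carrier : Set
    _≈_     : Carrier → Carrier → Set
    _+_ _*_ : Carrier → Carrier → Carrier
    -_      : Carrier → Carrier
    ι       : ℤ → Carrier
    isCommutativeRing : IsCommutativeRing _≈_ _+_ _*_ -_ (ι (+ 0)) (ι (+ 1))
    ι-+ : ∀ x y → ι (x ℤ.+ y) ≈ ι x + ι y
    ι-* : ∀ x y → ι (x ℤ.* y) ≈ ι x * ι y
    ι-neg : ∀ x → ι (ℤ.- x) ≈ - ι x

  commutativeRing : CommutativeRing 0ℓ 0ℓ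
  commutativeRing = record { isCommutativeRing = isCommutativeRing }

module Algebraic (𝒜 : IntegerAlgebra) where

  open IntegerAlgebra 𝒜 renaming (Carrier to A)
  open CommutativeRing commutativeRing
    using (setoid; semiring; _-_; 0#; 1#; +-cong; *-cong; -‿cong; distribˡ; zeroʳ; +-identityˡ; reflexive)
    renaming (refl to ≈-refl; sym to ≈-sym; trans to ≈-trans)
  open Exp semiring using (_^_)

  ι-morphism : ℤ.+-*-rawRing -Raw-AlmostCommutative⟶ fromCommutativeRing commutativeRing
  ι-morphism = record
    { ⟦_⟧ = ι ; +-homo = ι-+ ; *-homo = ι-* ; -‿homo = ι-neg ; 0-homo = ≈-refl ; 1-homo = ≈-refl }

  module ℛ = RingSolver ℤ.+-*-rawRing (fromCommutativeRing commutativeRing) ι-morphism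
    (λ x y → map (λ e → reflexive (cong ι e)) (dec⇒maybe (x ℤ.≟ y)))
  open ℛ using (solve; _:=_; _:+_; _:*_; _:-_; :-_; con)
  open SetoidReasoning setoid

  one : ∀ {n} → ℛ.Polynomial n
  one = con (+ 1)

  Sum : ℕ → (ℕ → A) → A
  Sum zero    f = 0#
  Sum (suc n) f = Sum n f + f n

  Sum-cong : ∀ n {f g} → (∀ i → i ℕ.< n → f i ≈ g i) → Sum n f ≈ Sum n g
  Sum-cong zero    h = ≈-refl
  Sum-cong (suc n) h = +-cong (Sum-cong n (λ i i<n → h i (ℕₚ.m<n⇒m<1+n i<n))) (h n ℕₚ.≤-refl)

  Sum-+ : ∀ n f g → Sum n f + Sum n g ≈ Sum n (λ i → f i + g i)
  Sum-+ zero    f g = +-identityˡ 0#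
  Sum-+ (suc n) f g = ≈-trans
    (solve 4 (λ a b c d → (a :+ b) :+ (c :+ d) := (a :+ c) :+ (b :+ d)) ≈-refl
      (Sum n f) (f n) (Sum n g) (g n))
    (+-cong (Sum-+ n f g) ≈-refl)

  Sum-*ˡ : ∀ n a f → a * Sum n f ≈ Sum n (λ i → a * f i)
  Sum-*ˡ zero    a f = zeroʳ a
  Sum-*ˡ (suc n) a f = ≈-trans (distribˡ a (Sum n f) (f n)) (+-cong (Sum-*ˡ n a f) ≈-refl)

  Sum-0 : ∀ n {f} → (∀ i → i ℕ.< n → f i ≈ 0#) → Sum n f ≈ 0#
  Sum-0 zero    h = ≈-refl
  Sum-0 (suc n) h = ≈-trans
    (+-cong (Sum-0 n (λ i i<n → h i (ℕₚ.m<n⇒m<1+n i<n))) (h n ℕₚ.≤-refl)) (+-identityˡ 0#)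

  Sum-drop : ∀ k n f → (∀ j → j ℕ.< k → f j ≈ 0#) → Sum (k ℕ.+ n) f ≈ Sum n (λ i → f (k ℕ.+ i))
  Sum-drop k zero    f h = ≈-trans (reflexive (cong (λ z → Sum z f) (ℕₚ.+-identityʳ k))) (Sum-0 k h)
  Sum-drop k (suc n) f h = ≈-trans (reflexive (cong (λ z → Sum z f) (ℕₚ.+-suc k n)))
    (+-cong (Sum-drop k n f h) ≈-refl)

  -- Coefficient k of (z + 1/z) Σ_k F_|k| z^k.
  neighbours : ℕ → (ℕ → A) → A
  neighbours zero    F = F 1 + F 1
  neighbours (suc k) F = F k + F (2 ℕ.+ k)

  neighbours-* : ∀ k a F → a * neighbours k F ≈ neighbours k (λ k′ → a * F k′)
  neighbours-* zero    a F = distribˡ a (F 1) (F 1)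
  neighbours-* (suc k) a F = distribˡ a (F k) (F (2 ℕ.+ k))

  neighbours-+* : ∀ k F G a → neighbours k F + a * neighbours k G ≈ neighbours k (λ k′ → F k′ + G k′ * a)
  neighbours-+* zero    F G a =
    solve 3 (λ f g a → f :+ f :+ a :* (g :+ g) := f :+ g :* a :+ (f :+ g :* a)) ≈-refl (F 1) (G 1) a
  neighbours-+* (suc k) F G a =
    solve 5 (λ f f′ g g′ a → f :+ f′ :+ a :* (g :+ g′) := f :+ g :* a :+ (f′ :+ g′ :* a)) ≈-refl
      (F k) (F (2 ℕ.+ k)) (G k) (G (2 ℕ.+ k)) a

  ι-lin : ∀ x y ε z → ι (x ℤ.+ y ℤ.- (ε ℤ.+ ε) ℤ.* z) ≈ ι x + ι y - (ι ε + ι ε) * ι z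
  ι-lin x y ε z = begin
    ι (x ℤ.+ y ℤ.- (ε ℤ.+ ε) ℤ.* z)             ≈⟨ ι-+ _ _ ⟩
    ι (x ℤ.+ y) + ι (ℤ.- ((ε ℤ.+ ε) ℤ.* z))     ≈⟨ +-cong (ι-+ x y) (ι-neg _) ⟩
    ι x + ι y - ι ((ε ℤ.+ ε) ℤ.* z)             ≈⟨ +-cong ≈-refl (-‿cong (ι-* _ _)) ⟩
    ι x + ι y - ι (ε ℤ.+ ε) * ι z               ≈⟨ +-cong ≈-refl (-‿cong (*-cong (ι-+ ε ε) ≈-refl)) ⟩
    ι x + ι y - (ι ε + ι ε) * ι z               ∎

  δ₀ : ℕ → A
  δ₀ zero    = 1#
  δ₀ (suc _) = 0#

  sg : ℕ → A
  sg zero    = 1#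
  sg (suc i) = - sg i

  -- p^(i(i-1)/2) when pw i = p^i.
  triangularPower : (ℕ → A) → ℕ → A
  triangularPower pw zero    = 1#
  triangularPower pw (suc i) = triangularPower pw i * pw i

  -- Partial fractions in z and their recurrence

  -- Here pw n = p^n and K n = 1/(p;p)_(n-1), with K 0 = 0; the nodes y_i = p^i y₀ satisfy y_i y_j = p^(i+j+b).
  module PartialFractions
    (pw : ℕ → A) (y₀ : A) (b : ℕ) (w K : ℕ → A)
    (pw-0 : pw 0 ≈ 1#)
    (pw-+ : ∀ m n → pw (m ℕ.+ n) ≈ pw m * pw n)
    (y₀² : y₀ * y₀ ≈ pw b)
    (K-one : K 1 ≈ 1#)
    (K-step : ∀ n → K n ≈ (1# - pw n) * K (suc n))
    (w-zero : w 0 * K b ≈ 1#)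
    (w-step : ∀ i → (1# - pw (suc i)) * w (suc i) ≈ (1# - pw (i ℕ.+ b)) * w i)
    (cancel : ∀ n x → (1# - pw (suc n)) * x ≈ 0# → x ≈ 0#)
    where

    -- `g i` is the part of the residue at `z = 1/y_i` that does not depend on `m`: the reciprocals
    -- of `1 - y_j/y_i` for `j < i` multiply to `(-1)^i p^(i(i+1)/2)/(p;p)_i`, and those of all
    -- `1 - y_i y_j` have numerator `(p;p)_(i+b-1)`.
    τ y g : ℕ → A
    τ = triangularPower pw
    y i = pw i * y₀
    g i = sg i * τ (suc i) * w i

    -- The nodes with `j > i` contribute `K (m ∸ i)`; `K (m + i + b)` is the remaining denominator
    -- of the product of all `1/(1 - y_i y_j)`.
    c : ℕ → ℕ → A
    c m i = g i * K (m ∸ i) * K (m ℕ.+ i ℕ.+ b)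

    -- Coefficient of z^k in Π_{i<m} 1/((1 - z y_i)(1 - y_i/z)); c m i is the coefficient of
    -- 1/(1 - z y_i) in its partial fraction expansion.
    B : ℕ → ℕ → A
    B k zero    = δ₀ k
    B k (suc M) = Sum (suc M) (λ i → c (suc M) i * y i ^ k)

    B-suc : ∀ k m → B (suc k) m ≈ Sum m (λ i → c m i * y i ^ suc k)
    B-suc k zero    = ≈-refl
    B-suc k (suc M) = ≈-refl

    K-zero : K 0 ≈ 0#
    K-zero = begin
      K 0                     ≈⟨ K-step 0 ⟩
      (1# - pw 0) * K 1     ≈⟨ *-cong (+-cong ≈-refl (-‿cong pw-0)) ≈-refl ⟩
      (1# - 1#) * K 1       ≈⟨ solve 1 (λ x → (one :- one) :* x := con (+ 0)) ≈-refl (K 1) ⟩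
      0#                      ∎

    pw-+₃ : ∀ m i → pw (m ℕ.+ i ℕ.+ b) ≈ pw m * pw i * pw b
    pw-+₃ m i = ≈-trans (pw-+ (m ℕ.+ i) b) (*-cong (pw-+ m i) ≈-refl)

    y*y : ∀ m i → y m * y i ≈ pw (m ℕ.+ i ℕ.+ b)
    y*y m i = begin
      pw m * y₀ * (pw i * y₀)   ≈⟨ solve 3 (λ m i y → m :* y :* (i :* y) := m :* i :* (y :* y)) ≈-refl (pw m) (pw i) y₀ ⟩
      pw m * pw i * (y₀ * y₀)   ≈⟨ *-cong ≈-refl y₀² ⟩
      pw m * pw i * pw b         ≈⟨ pw-+₃ m i ⟨
      pw (m ℕ.+ i ℕ.+ b)           ∎

    pw-∸ : ∀ {M i} → i ℕ.≤ M → pw M ≈ pw i * pw (M ∸ i)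
    pw-∸ {M} {i} i≤M = ≈-trans (reflexive (cong pw (sym (ℕₚ.m+[n∸m]≡n i≤M)))) (pw-+ i (M ∸ i))

    y-∸ : ∀ {M i} → i ℕ.≤ M → y M ≈ pw (M ∸ i) * y i
    y-∸ {M} {i} i≤M = begin
      pw M * y₀                    ≈⟨ *-cong (pw-∸ i≤M) ≈-refl ⟩
      pw i * pw (M ∸ i) * y₀      ≈⟨ solve 3 (λ a b c → a :* b :* c := b :* (a :* c)) ≈-refl (pw i) (pw (M ∸ i)) y₀ ⟩
      pw (M ∸ i) * y i             ∎

    K-∸ : ∀ {M i} → i ℕ.≤ M → K (M ∸ i) ≈ (1# - pw (M ∸ i)) * K (suc M ∸ i)
    K-∸ {M} {i} i≤M = ≈-trans (K-step (M ∸ i))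
      (*-cong ≈-refl (reflexive (cong K (sym (ℕₚ.+-∸-assoc 1 i≤M)))))

    -- The factor with index `M` enters the residue at `1/y_i` as `(1 - y_M/y_i)(1 - y_M y_i)`, and
    -- `y_M/y_i = p^(M-i)`. At `i = M` both sides vanish, thanks to `K 0 = 0`.
    c-step : ∀ {M i} → i ℕ.≤ M →
      c (suc M) i * ((1# - pw (M ∸ i)) * (1# - y M * y i)) ≈ c M i
    c-step {M} {i} i≤M = begin
      g i * K₁ * K₂ * ((1# - l) * (1# - y M * y i))
        ≈⟨ *-cong ≈-refl (*-cong ≈-refl (+-cong ≈-refl (-‿cong (y*y M i)))) ⟩
      g i * K₁ * K₂ * ((1# - l) * (1# - z))
        ≈⟨ solve 5 (λ g k k′ l z → g :* k :* k′ :* ((one :- l) :* (one :- z)) := g :* ((one :- l) :* k) :* ((one :- z) :* k′))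
             ≈-refl (g i) K₁ K₂ l z ⟩
      g i * ((1# - l) * K₁) * ((1# - z) * K₂)
        ≈⟨ *-cong (*-cong ≈-refl (K-∸ i≤M)) (K-step (M ℕ.+ i ℕ.+ b)) ⟨
      c M i ∎
      where
      K₁ = K (suc M ∸ i)
      K₂ = K (suc M ℕ.+ i ℕ.+ b)
      l = pw (M ∸ i)
      z = pw (M ℕ.+ i ℕ.+ b)

    Sum-c-last : ∀ M (f : ℕ → A) → Sum (suc M) (λ i → c M i * f i) ≈ Sum M (λ i → c M i * f i)
    Sum-c-last M f = begin
      S + g M * K (M ∸ M) * x * f M
        ≈⟨ +-cong ≈-refl (*-cong (*-cong (*-cong ≈-refl (≈-trans (reflexive (cong K (ℕₚ.n∸n≡0 M))) K-zero)) ≈-refl) ≈-refl) ⟩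
      S + g M * 0# * x * f M
        ≈⟨ solve 4 (λ s g x f → s :+ g :* con (+ 0) :* x :* f := s) ≈-refl S (g M) x (f M) ⟩
      S ∎
      where
      S = Sum M (λ i → c M i * f i)
      x = K (M ℕ.+ M ℕ.+ b)

    Sum-lin : ∀ n u v f f′ f″ →
      u * Sum n f - v * (Sum n f′ + Sum n f″) ≈ Sum n (λ i → u * f i - v * (f′ i + f″ i))
    Sum-lin zero u v f f′ f″ =
      solve 2 (λ u v → u :* con (+ 0) :- v :* (con (+ 0) :+ con (+ 0)) := con (+ 0)) ≈-refl u v
    Sum-lin (suc n) u v f f′ f″ = ≈-trans
      (solve 8 (λ u v a b a′ b′ a″ b″ → u :* (a :+ b) :- v :* ((a′ :+ b′) :+ (a″ :+ b″))
          := (u :* a :- v :* (a′ :+ a″)) :+ (u :* b :- v :* (b′ :+ b″))) ≈-refl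
        u v (Sum n f) (f n) (Sum n f′) (f′ n) (Sum n f″) (f″ n))
      (+-cong (Sum-lin n u v f f′ f″) ≈-refl)

    -- Multiplication by `(1 - z y_M)(1 - y_M/z)` acts on the geometric sequence `y_i^k` as a
    -- scalar, and `c-step` says what that scalar does to the coefficient. For a positive index no
    -- negative power of `y_i` arises, so the argument is termwise.
    B-rec-suc : ∀ k M →
      (1# + y M * y M) * B (suc k) (suc M) - y M * (B k (suc M) + B (2 ℕ.+ k) (suc M)) ≈ B (suc k) M
    B-rec-suc k M = begin
      (1# + y M * y M) * B (suc k) (suc M) - y M * (B k (suc M) + B (2 ℕ.+ k) (suc M))
        ≈⟨ Sum-lin (suc M) _ (y M) _ _ _ ⟩
      Sum (suc M) (λ i → (1# + y M * y M) * (c (suc M) i * y i ^ suc k)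
                         - y M * (c (suc M) i * y i ^ k + c (suc M) i * y i ^ (2 ℕ.+ k)))
        ≈⟨ Sum-cong (suc M) (λ i → term i ∘ ℕₚ.≤-pred) ⟩
      Sum (suc M) (λ i → c M i * y i ^ suc k)
        ≈⟨ Sum-c-last M _ ⟩
      Sum M (λ i → c M i * y i ^ suc k)
        ≈⟨ B-suc k M ⟨
      B (suc k) M ∎
      where
      term : ∀ i → i ℕ.≤ M → (1# + y M * y M) * (c (suc M) i * y i ^ suc k)
               - y M * (c (suc M) i * y i ^ k + c (suc M) i * y i ^ (2 ℕ.+ k))
             ≈ c M i * y i ^ suc k
      term i i≤M = begin
        (1# + y M * y M) * (Cᵢ * (Y * Yᵏ)) - y M * (Cᵢ * Yᵏ + Cᵢ * (Y * (Y * Yᵏ)))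
          ≈⟨ solve 4 (λ m c y z → (one :+ m :* m) :* (c :* (y :* z)) :- m :* (c :* z :+ c :* (y :* (y :* z)))
               := (one :+ m :* m :- m :* y) :* c :* (y :* z) :- m :* (c :* z)) ≈-refl (y M) Cᵢ Y Yᵏ ⟩
        (1# + y M * y M - y M * Y) * Cᵢ * (Y * Yᵏ) - y M * (Cᵢ * Yᵏ)
          -- Substituting `l * Y` for `y M` stands in for the division `y M / Y`.
          ≈⟨ +-cong (*-cong (*-cong (+-cong (+-cong ≈-refl (*-cong ≈-refl (y-∸ i≤M))) ≈-refl) ≈-refl) ≈-refl)
                    (-‿cong (*-cong (y-∸ i≤M) ≈-refl)) ⟩
        (1# + y M * (l * Y) - y M * Y) * Cᵢ * (Y * Yᵏ) - l * Y * (Cᵢ * Yᵏ)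
          ≈⟨ solve 5 (λ m l c y z → (one :+ m :* (l :* y) :- m :* y) :* c :* (y :* z) :- l :* y :* (c :* z)
               := c :* ((one :- l) :* (one :- m :* y)) :* (y :* z)) ≈-refl (y M) l Cᵢ Y Yᵏ ⟩
        Cᵢ * ((1# - l) * (1# - y M * Y)) * (Y * Yᵏ)
          ≈⟨ *-cong (c-step i≤M) ≈-refl ⟩
        c M i * (Y * Yᵏ) ∎
        where
        Cᵢ = c (suc M) i
        Y = y i
        Yᵏ = y i ^ k
        l = pw (M ∸ i)

    -- Σ_i t M i = 0 says that the partial fraction formula takes equal values at k = 1 and k = -1;
    -- its partial sums are hypergeometric, with the closed form found by Gosper's algorithm.
    t : ℕ → ℕ → A
    t M i = sg i * τ i * w i * (1# - pw (i ℕ.+ i ℕ.+ b)) * K (suc M ∸ i) * K (suc M ℕ.+ i ℕ.+ b)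

    -- The right-hand side vanishes at `n = 0` through `1 - pw 0` and at `n = M + 1` through `K 0`.
    -- The product `(1 - pw n) * w n` is kept together so that `w-step` applies without division.
    Sum-t : ∀ M n → n ℕ.≤ suc M → (1# - pw M) * Sum n (t M)
      ≈ - (sg n * τ n * ((1# - pw n) * w n) * K (suc M ∸ n) * K (M ℕ.+ n ℕ.+ b))
    Sum-t M zero _ = begin
      (1# - pw M) * 0#
        ≈⟨ solve 4 (λ m w k k′ → (one :- m) :* con (+ 0) := :- (one :* one :* ((one :- one) :* w) :* k :* k′)) ≈-refl
             (pw M) (w 0) (K (suc M)) (K (M ℕ.+ 0 ℕ.+ b)) ⟩
      - (1# * 1# * ((1# - 1#) * w 0) * K (suc M) * K (M ℕ.+ 0 ℕ.+ b))
        ≈⟨ -‿cong (*-cong (*-cong (*-cong ≈-refl (*-cong (+-cong ≈-refl (-‿cong pw-0)) ≈-refl)) ≈-refl) ≈-refl) ⟨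
      - (1# * 1# * ((1# - pw 0) * w 0) * K (suc M) * K (M ℕ.+ 0 ℕ.+ b)) ∎
    Sum-t M (suc i) (s≤s i≤M) = begin
      (1# - pw M) * (Sum i (t M) + t M i)
        ≈⟨ distribˡ _ _ _ ⟩
      (1# - pw M) * Sum i (t M) + (1# - pw M) * t M i
        ≈⟨ +-cong (≈-trans (Sum-t M i (ℕₚ.m≤n⇒m≤1+n i≤M)) (-‿cong (*-cong ≈-refl K-big)))
                  (*-cong (+-cong ≈-refl (-‿cong (pw-∸ i≤M)))
                          (*-cong (*-cong (*-cong ≈-refl (+-cong ≈-refl (-‿cong (pw-+₃ i i)))) ≈-refl) ≈-refl)) ⟩
      - (s * T * ((1# - x) * v) * K₁ * ((1# - x * l * x * β) * K₂))
        + (1# - x * l) * (s * T * v * (1# - x * x * β) * K₁ * K₂)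
        ≈⟨ solve 8 (λ s T x v l β k k′ →
             :- (s :* T :* ((one :- x) :* v) :* k :* ((one :- x :* l :* x :* β) :* k′))
               :+ (one :- x :* l) :* (s :* T :* v :* (one :- x :* x :* β) :* k :* k′)
             := :- ((:- s) :* (T :* x) :* ((one :- x :* β) :* v) :* ((one :- l) :* k) :* k′))
             ≈-refl s T x v l β K₁ K₂ ⟩
      - ((- s) * (T * x) * ((1# - x * β) * v) * ((1# - l) * K₁) * K₂)
        ≈⟨ -‿cong (*-cong (*-cong (*-cong ≈-refl w-next) (K-∸ i≤M)) (reflexive (cong K idx))) ⟨
      - (sg (suc i) * τ (suc i) * ((1# - pw (suc i)) * w (suc i)) * K (M ∸ i) * K (M ℕ.+ suc i ℕ.+ b)) ∎
      where
      s = sg i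
      T = τ i
      x = pw i
      v = w i
      l = pw (M ∸ i)
      β = pw b
      K₁ = K (suc M ∸ i)
      K₂ = K (suc M ℕ.+ i ℕ.+ b)
      idx : M ℕ.+ suc i ℕ.+ b ≡ suc M ℕ.+ i ℕ.+ b
      idx = cong (ℕ._+ b) (ℕₚ.+-suc M i)
      K-big : K (M ℕ.+ i ℕ.+ b) ≈ (1# - x * l * x * β) * K₂
      K-big = ≈-trans (K-step (M ℕ.+ i ℕ.+ b)) (*-cong (+-cong ≈-refl (-‿cong
        (≈-trans (pw-+₃ M i) (*-cong (*-cong (pw-∸ i≤M) ≈-refl) ≈-refl)))) ≈-refl)
      w-next : (1# - pw (suc i)) * w (suc i) ≈ (1# - x * β) * v
      w-next = ≈-trans (w-step i) (*-cong (+-cong ≈-refl (-‿cong (pw-+ i b))) ≈-refl)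

    Sum-t≈0 : ∀ M → Sum (2 ℕ.+ M) (t (suc M)) ≈ 0#
    Sum-t≈0 M = cancel M _ (begin
      (1# - pw (suc M)) * Sum (2 ℕ.+ M) (t (suc M))
        ≈⟨ Sum-t (suc M) (2 ℕ.+ M) ℕₚ.≤-refl ⟩
      - (u * K (M ∸ M) * k)
        ≈⟨ -‿cong (*-cong (*-cong ≈-refl (≈-trans (reflexive (cong K (ℕₚ.n∸n≡0 M))) K-zero)) ≈-refl) ⟩
      - (u * 0# * k)
        ≈⟨ solve 2 (λ u k → :- (u :* con (+ 0) :* k) := con (+ 0)) ≈-refl u k ⟩
      0# ∎)
      where
      u = sg (2 ℕ.+ M) * τ (2 ℕ.+ M) * ((1# - pw (2 ℕ.+ M)) * w (2 ℕ.+ M))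
      k = K (suc M ℕ.+ (2 ℕ.+ M) ℕ.+ b)

    B-rec-zero : ∀ M →
      (1# + y M * y M) * B 0 (suc M) - y M * (B 1 (suc M) + B 1 (suc M)) ≈ B 0 M
    -- Here `Sum-t` carries the factor `1 - pw 0`, which cannot be cancelled, and `B 0 0` is 1
    -- rather than an empty sum. The direct computation is where the normalisation `w-zero` enters.
    B-rec-zero zero = begin
      (1# + y 0 * y 0) * (0# + Cᵢ * 1#) - y 0 * (B 1 1 + B 1 1)
        ≈⟨ solve 2 (λ y c → (one :+ y :* y) :* (con (+ 0) :+ c :* one) :- y :* ((con (+ 0) :+ c :* (y :* one)) :+ (con (+ 0) :+ c :* (y :* one)))
             := (one :- y :* y) :* c) ≈-refl (y 0) Cᵢ ⟩
      (1# - y 0 * y 0) * (1# * (1# * pw 0) * w 0 * K 1 * K (suc b))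
        ≈⟨ *-cong (+-cong ≈-refl (-‿cong (y*y 0 0)))
             (*-cong (*-cong (*-cong (*-cong ≈-refl (*-cong ≈-refl pw-0)) ≈-refl) K-one) ≈-refl) ⟩
      (1# - pw b) * (1# * (1# * 1#) * w 0 * 1# * K (suc b))
        ≈⟨ solve 3 (λ β w k → (one :- β) :* (one :* (one :* one) :* w :* one :* k) := w :* ((one :- β) :* k)) ≈-refl (pw b) (w 0) (K (suc b)) ⟩
      w 0 * ((1# - pw b) * K (suc b))
        ≈⟨ *-cong ≈-refl (K-step b) ⟨
      w 0 * K b
        ≈⟨ w-zero ⟩
      1# ∎
      where Cᵢ = c 1 0
    B-rec-zero M@(suc M′) = begin
      (1# + y M * y M) * B 0 (suc M) - y M * (B 1 (suc M) + B 1 (suc M))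
        ≈⟨ Sum-lin (suc M) _ (y M) _ _ _ ⟩
      Sum (suc M) (λ i → (1# + y M * y M) * (c (suc M) i * 1#)
                         - y M * (c (suc M) i * y i ^ 1 + c (suc M) i * y i ^ 1))
        ≈⟨ Sum-cong (suc M) (λ i → term i ∘ ℕₚ.≤-pred) ⟩
      Sum (suc M) (λ i → c M i * 1# + pw M * t M i)
        ≈⟨ Sum-+ (suc M) (λ i → c M i * 1#) (λ i → pw M * t M i) ⟨
      Sum (suc M) (λ i → c M i * 1#) + Sum (suc M) (λ i → pw M * t M i)
        ≈⟨ +-cong (Sum-c-last M _) (≈-trans (≈-sym (Sum-*ˡ (suc M) (pw M) (t M))) (*-cong ≈-refl (Sum-t≈0 M′))) ⟩
      B 0 M + pw M * 0#
        ≈⟨ solve 2 (λ x y → x :+ y :* con (+ 0) := x) ≈-refl (B 0 M) (pw M) ⟩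
      B 0 M ∎
      where
      term : ∀ i → i ℕ.≤ M → (1# + y M * y M) * (c (suc M) i * 1#)
               - y M * (c (suc M) i * y i ^ 1 + c (suc M) i * y i ^ 1)
             ≈ c M i * 1# + pw M * t M i
      term i i≤M = begin
        (1# + y M * y M) * (Cᵢ * 1#) - y M * (Cᵢ * (Y * 1#) + Cᵢ * (Y * 1#))
          ≈⟨ +-cong (*-cong (+-cong ≈-refl (*-cong ≈-refl (y-∸ i≤M))) ≈-refl) ≈-refl ⟩
        (1# + y M * (l * Y)) * (Cᵢ * 1#) - y M * (Cᵢ * (Y * 1#) + Cᵢ * (Y * 1#))
          ≈⟨ solve 4 (λ m l c y → (one :+ m :* (l :* y)) :* (c :* one) :- m :* (c :* (y :* one) :+ c :* (y :* one))
               := c :* ((one :- l) :* (one :- m :* y)) :* one :+ c :* (l :- m :* y)) ≈-refl (y M) l Cᵢ Y ⟩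
        Cᵢ * ((1# - l) * (1# - y M * Y)) * 1# + Cᵢ * (l - y M * Y)
          ≈⟨ +-cong (*-cong (c-step i≤M) ≈-refl) boundary ⟩
        c M i * 1# + pw M * t M i ∎
        where
        Cᵢ = c (suc M) i
        Y = y i
        l = pw (M ∸ i)
        x = pw i
        K₁ = K (suc M ∸ i)
        K₂ = K (suc M ℕ.+ i ℕ.+ b)
        -- Using `y_i` twice in place of `y_i` and `1/y_i` leaves the excess `y_M/y_i - y_M y_i =
        -- p^(M-i)(1 - p^(2i+b))`. The last factor `p^i` of `τ (suc
        -- i)` completes `p^(M-i)` to `p^M`, the same for all `i`.
        boundary : Cᵢ * (l - y M * Y) ≈ pw M * t M i
        boundary = begin
          Cᵢ * (l - y M * Y)
            ≈⟨ *-cong ≈-refl (+-cong ≈-refl (-‿cong (≈-trans (y*y M i) (≈-trans (pw-+₃ M i) (*-cong (*-cong (pw-∸ i≤M) ≈-refl) ≈-refl))))) ⟩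
          sg i * (τ i * x) * w i * K₁ * K₂ * (l - x * l * x * pw b)
            ≈⟨ solve 8 (λ s T x w k k′ l β → s :* (T :* x) :* w :* k :* k′ :* (l :- x :* l :* x :* β)
                 := x :* l :* (s :* T :* w :* (one :- x :* x :* β) :* k :* k′)) ≈-refl (sg i) (τ i) x (w i) K₁ K₂ l (pw b) ⟩
          x * l * (sg i * τ i * w i * (1# - x * x * pw b) * K₁ * K₂)
            ≈⟨ *-cong (pw-∸ i≤M) (*-cong (*-cong (*-cong ≈-refl (+-cong ≈-refl (-‿cong (pw-+₃ i i)))) ≈-refl) ≈-refl) ⟨
          pw M * t M i ∎

    B-rec : ∀ k M →
      (1# + y M * y M) * B k (suc M) - y M * neighbours k (λ k′ → B k′ (suc M)) ≈ B k M
    B-rec zero    = B-rec-zero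
    B-rec (suc k) = B-rec-suc k

    -- Since `τ (i+1) p^(i+1) = τ (i+2)`, splitting `1 - p^(i+1)` yields the same alternating sum
    -- twice, once multiplied by `z` and once shifted by one index; the shift leaves `-1` and the
    -- last term. With `z = q^k` this produces the bracket of the V identity.
    Sum-telescope : ∀ z n → Sum n (λ i → sg i * τ (suc i) * (1# - pw (suc i)) * z ^ suc i)
      ≈ - 1# + (1# + z) * Sum n (λ i → sg i * τ (suc i) * z ^ i) + sg n * τ (suc n) * z ^ n
    Sum-telescope z zero = begin
      0#
        ≈⟨ solve 1 (λ z → con (+ 0) := :- one :+ (one :+ z) :* con (+ 0) :+ one :* (one :* one) :* one) ≈-refl z ⟩
      - 1# + (1# + z) * 0# + 1# * (1# * 1#) * 1#
        ≈⟨ +-cong ≈-refl (*-cong (*-cong ≈-refl (*-cong ≈-refl pw-0)) ≈-refl) ⟨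
      - 1# + (1# + z) * 0# + 1# * (1# * pw 0) * 1# ∎
    Sum-telescope z (suc n) = ≈-trans (+-cong (Sum-telescope z n) ≈-refl)
      (solve 6 (λ z S s t p x →
           :- one :+ (one :+ z) :* S :+ s :* t :* x :+ s :* t :* (one :- p) :* (z :* x)
        := :- one :+ (one :+ z) :* (S :+ s :* t :* x) :+ (:- s) :* (t :* p) :* (z :* x)) ≈-refl
        z (Sum n (λ i → sg i * τ (suc i) * z ^ i)) (sg n) (τ (suc n)) (pw (suc n)) (z ^ n))

    module _ (E : A) (E² : E * E ≈ 1#) where

      P : ℕ → A
      P zero    = 1#
      P (suc M) = P M * (1# - E * y M)

      D : ℕ → ℕ → A
      D k m = P m * P m * B k m

      D-zero : ∀ k → D k 0 ≈ δ₀ k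
      D-zero k = solve 1 (λ x → one :* one :* x := x) ≈-refl (δ₀ k)

      -- By `E² = 1`, `1 + y²` equals `(1 - E y)² + 2 E y`; this trades `z + 1/z` for `z + 1/z - 2E`
      -- and brings the recurrence into the shape of `T-rec`.
      D-rec : ∀ k M → (1# - E * y M) * (1# - E * y M) * D k (suc M)
        ≈ (1# - E * y M) * (1# - E * y M) * D k M
          + y M * (neighbours k (λ k′ → D k′ (suc M)) - (E + E) * D k (suc M))
      D-rec k M = begin
        s * (P (suc M) * P (suc M) * B k (suc M))
          ≈⟨ solve 4 (λ p e y b → (one :- e :* y) :* (one :- e :* y) :* (p :* (one :- e :* y) :* (p :* (one :- e :* y)) :* b)
               := (one :- e :* y) :* (one :- e :* y) :* (p :* p) :* (one :- e :* y :- e :* y :+ e :* e :* (y :* y)) :* b) ≈-refl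
               (P M) E (y M) (B k (suc M)) ⟩
        s * (P M * P M) * (1# - E * y M - E * y M + E * E * (y M * y M)) * B k (suc M)
          ≈⟨ *-cong (*-cong ≈-refl (+-cong ≈-refl (*-cong E² ≈-refl))) ≈-refl ⟩
        s * (P M * P M) * (1# - E * y M - E * y M + 1# * (y M * y M)) * B k (suc M)
          ≈⟨ solve 5 (λ p e y b n →
               (one :- e :* y) :* (one :- e :* y) :* (p :* p) :* (one :- e :* y :- e :* y :+ one :* (y :* y)) :* b
               := (one :- e :* y) :* (one :- e :* y) :* (p :* p :* ((one :+ y :* y) :* b :- y :* n))
                  :+ y :* (p :* (one :- e :* y) :* (p :* (one :- e :* y)) :* n
                           :- (e :+ e) :* (p :* (one :- e :* y) :* (p :* (one :- e :* y)) :* b))) ≈-refl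
               (P M) E (y M) (B k (suc M)) (neighbours k (λ k′ → B k′ (suc M))) ⟩
        s * (P M * P M * ((1# + y M * y M) * B k (suc M) - y M * neighbours k (λ k′ → B k′ (suc M))))
          + y M * (P (suc M) * P (suc M) * neighbours k (λ k′ → B k′ (suc M)) - (E + E) * D k (suc M))
          ≈⟨ +-cong (*-cong ≈-refl (*-cong ≈-refl (B-rec k M)))
                    (*-cong ≈-refl (+-cong (neighbours-* k _ _) ≈-refl)) ⟩
        s * D k M + y M * (neighbours k (λ k′ → D k′ (suc M)) - (E + E) * D k (suc M)) ∎
        where s = (1# - E * y M) * (1# - E * y M)

  -- The generating function of the chain sums

  ι-centralCoeff : ∀ ε k j → ι (centralCoeff ε k (suc j))
    ≈ neighbours k (λ k′ → ι (centralCoeff ε k′ j)) - (ι ε + ι ε) * ι (centralCoeff ε k j)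
  ι-centralCoeff ε zero    j = ι-lin (centralCoeff ε 1 j) (centralCoeff ε 1 j) ε (centralCoeff ε 0 j)
  ι-centralCoeff ε (suc k) j = ι-lin (centralCoeff ε k j) (centralCoeff ε (2 ℕ.+ k) j) ε (centralCoeff ε (suc k) j)

  module ChainRecurrence
    (ε : ℤ) (y f : ℕ → A) (h : ℕ → ℕ → A)
    (h-zero : ∀ m → h 0 m ≈ 1#)
    (h-nil : ∀ j → h (suc j) 0 ≈ 0#)
    (h-step : ∀ j m → h (suc j) (suc m) ≈ h (suc j) m + f (suc m) * h j (suc m))
    (f-clear : ∀ M → (1# - ι ε * y M) * (1# - ι ε * y M) * f (suc M) ≈ y M)
    where

    -- The coefficient of `z^k` in the first `L` terms of `Σ_j x^j h_j(m)`, where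
    -- `x = z + 1/z - 2ε`; it is truncated because the abstract ring has no infinite sums.
    T : ℕ → ℕ → ℕ → A
    T L k m = Sum L (λ j → ι (centralCoeff ε k j) * h j m)

    T-zero : ∀ L k → T (suc L) k 0 ≈ δ₀ k
    T-zero zero    k = ≈-trans (+-cong ≈-refl (*-cong (initial k) (h-zero 0)))
      (solve 1 (λ x → con (+ 0) :+ x :* one := x) ≈-refl (δ₀ k))
      where
      initial : ∀ k → ι (centralCoeff ε k 0) ≈ δ₀ k
      initial zero    = ≈-refl
      initial (suc k) = ≈-refl
    T-zero (suc L) k = ≈-trans (+-cong (T-zero L k) (*-cong ≈-refl (h-nil L)))
      (solve 2 (λ x y → x :+ y :* con (+ 0) := x) ≈-refl (δ₀ k) (ι (centralCoeff ε k (suc L))))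

    -- Passing from `M` to `M + 1` adds `f (suc M) * h j (suc M)` to `h (suc j)`, and
    -- `x^(j+1) = x x^j` makes this `x` times the term of index `j`. Hence the last part has one
    -- summand fewer; clearing `(1 - εy)²` turns `f` into `y`.
    T-rec : ∀ L k M → (1# - ι ε * y M) * (1# - ι ε * y M) * T (suc L) k (suc M)
      ≈ (1# - ι ε * y M) * (1# - ι ε * y M) * T (suc L) k M
        + y M * (neighbours k (λ k′ → T L k′ (suc M)) - (ι ε + ι ε) * T L k (suc M))
    T-rec zero k M = begin
      s * (0# + a * h 0 (suc M))
        ≈⟨ *-cong ≈-refl (+-cong ≈-refl (*-cong ≈-refl (≈-trans (h-zero (suc M)) (≈-sym (h-zero M))))) ⟩
      s * (0# + a * h 0 M)
        ≈⟨ solve 3 (λ s y e → s := s :+ y :* (con (+ 0) :+ con (+ 0) :- (e :+ e) :* con (+ 0))) ≈-refl (s * (0# + a * h 0 M)) (y M) (ι ε) ⟩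
      s * (0# + a * h 0 M) + y M * (0# + 0# - (ι ε + ι ε) * 0#)
        ≈⟨ +-cong ≈-refl (*-cong ≈-refl (+-cong (neighbours-0 k) ≈-refl)) ⟩
      s * (0# + a * h 0 M) + y M * (neighbours k (λ _ → 0#) - (ι ε + ι ε) * 0#) ∎
      where
      s = (1# - ι ε * y M) * (1# - ι ε * y M)
      a = ι (centralCoeff ε k 0)
      neighbours-0 : ∀ k → 0# + 0# ≈ neighbours k (λ _ → 0#)
      neighbours-0 zero    = ≈-refl
      neighbours-0 (suc k) = ≈-refl
    T-rec (suc L) k M = begin
      s * (T (suc L) k (suc M) + a * h (suc L) (suc M))
        ≈⟨ *-cong ≈-refl (+-cong ≈-refl (*-cong ≈-refl (h-step L M))) ⟩
      s * (T (suc L) k (suc M) + a * (h (suc L) M + f (suc M) * H))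
        ≈⟨ solve 6 (λ s t a h f h′ → s :* (t :+ a :* (h :+ f :* h′)) := s :* t :+ s :* (a :* h) :+ a :* (s :* f :* h′)) ≈-refl
             s (T (suc L) k (suc M)) a (h (suc L) M) (f (suc M)) H ⟩
      s * T (suc L) k (suc M) + s * (a * h (suc L) M) + a * (s * f (suc M) * H)
        ≈⟨ +-cong (+-cong (T-rec L k M) ≈-refl) (*-cong (ι-centralCoeff ε k L) (*-cong (f-clear M) ≈-refl)) ⟩
      s * T (suc L) k M + y M * (n - (ι ε + ι ε) * T L k (suc M)) + s * (a * h (suc L) M)
        + (n′ - (ι ε + ι ε) * a′) * (y M * H)
        ≈⟨ solve 10 (λ s t y n e t′ u n′ a′ h → s :* t :+ y :* (n :- (e :+ e) :* t′) :+ s :* u :+ (n′ :- (e :+ e) :* a′) :* (y :* h)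
             := s :* (t :+ u) :+ y :* (n :+ h :* n′ :- (e :+ e) :* (t′ :+ a′ :* h))) ≈-refl
             s (T (suc L) k M) (y M) n (ι ε) (T L k (suc M)) (a * h (suc L) M) n′ a′ H ⟩
      s * (T (suc L) k M + a * h (suc L) M) + y M * (n + H * n′ - (ι ε + ι ε) * (T L k (suc M) + a′ * H))
        ≈⟨ +-cong ≈-refl (*-cong ≈-refl (+-cong (neighbours-+* k _ _ H) ≈-refl)) ⟩
      s * T (2 ℕ.+ L) k M + y M * (neighbours k (λ k′ → T (suc L) k′ (suc M)) - (ι ε + ι ε) * T (suc L) k (suc M)) ∎
      where
      s = (1# - ι ε * y M) * (1# - ι ε * y M)
      a = ι (centralCoeff ε k (suc L))
      a′ = ι (centralCoeff ε k L)
      H = h L (suc M)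
      n = neighbours k (λ k′ → T L k′ (suc M))
      n′ = neighbours k (λ k′ → ι (centralCoeff ε k′ L))

-- The ring of formal power series

infix 4 _≈_ _≈[_]_

-- A record keeps the two series visible to unification, where a pointwise equation would unfold to
-- integers.
record _≈_ (a b : PS) : Set where
  constructor mk≈
  field at : ∀ n → a n ≡ b n
open _≈_

record _≈[_]_ (a : PS) (N : ℕ) (b : PS) : Set where
  constructor mk≈[]
  field at< : ∀ n → n ℕ.< N → a n ≡ b n
open _≈[_]_

tail : PS → PS
tail a n = a (suc n)

-ₚ_ : PS → PS
(-ₚ a) n = ℤ.- a n

sumUpTo-suc : ∀ n (f : ℕ → ℤ) → sumUpTo (suc n) f ≡ f 0 ℤ.+ sumUpTo n (f ∘ suc)
sumUpTo-suc zero    f = refl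
sumUpTo-suc (suc n) f = begin
  sumUpTo (suc n) f ℤ.+ f (2 ℕ.+ n)                   ≡⟨ cong (ℤ._+ f (2 ℕ.+ n)) (sumUpTo-suc n f) ⟩
  f 0 ℤ.+ sumUpTo n (f ∘ suc) ℤ.+ f (2 ℕ.+ n)         ≡⟨ ℤₚ.+-assoc (f 0) (sumUpTo n (f ∘ suc)) (f (2 ℕ.+ n)) ⟩
  f 0 ℤ.+ (sumUpTo n (f ∘ suc) ℤ.+ f (2 ℕ.+ n))       ∎
  where open ≡-Reasoning

sumUpTo-cong : ∀ n {f g : ℕ → ℤ} → (∀ i → i ℕ.≤ n → f i ≡ g i) → sumUpTo n f ≡ sumUpTo n g
sumUpTo-cong zero    h = h 0 z≤n
sumUpTo-cong (suc n) h =
  cong₂ ℤ._+_ (sumUpTo-cong n (λ i i≤n → h i (ℕₚ.m≤n⇒m≤1+n i≤n))) (h (suc n) ℕₚ.≤-refl)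

-- Peeling the constant term off the left factor makes the Cauchy product recursive; the ring laws
-- then follow by induction on the coefficient index, for all series at once.
*ₚ-suc : ∀ a b n → (a *ₚ b) (suc n) ≡ a 0 ℤ.* b (suc n) ℤ.+ (tail a *ₚ b) n
*ₚ-suc a b n = sumUpTo-suc n (λ i → a i ℤ.* b (suc n ∸ i))

*ₚ-cong-≤ : ∀ {a a′ b b′} n → (∀ i → i ℕ.≤ n → a i ≡ a′ i) → (∀ i → i ℕ.≤ n → b i ≡ b′ i) →
            (a *ₚ b) n ≡ (a′ *ₚ b′) n
*ₚ-cong-≤ n h h′ = sumUpTo-cong n (λ i i≤n → cong₂ ℤ._*_ (h i i≤n) (h′ (n ∸ i) (ℕₚ.m∸n≤m n i)))

*ₚ-congˡ-at : ∀ {a a′} b n → (∀ i → a i ≡ a′ i) → (a *ₚ b) n ≡ (a′ *ₚ b) n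
*ₚ-congˡ-at b n h = *ₚ-cong-≤ {b = b} {b} n (λ i _ → h i) (λ _ _ → refl)

distribʳ-at : ∀ a b c n → ((a +ₚ b) *ₚ c) n ≡ (a *ₚ c) n ℤ.+ (b *ₚ c) n
distribʳ-at a b c zero = ℤₚ.*-distribʳ-+ (c 0) (a 0) (b 0)
distribʳ-at a b c (suc n)
  rewrite *ₚ-suc (a +ₚ b) c n | *ₚ-suc a c n | *ₚ-suc b c n | distribʳ-at (tail a) (tail b) c n =
  solve 5 (λ x y z u v → (x :+ y) :* z :+ (u :+ v) := x :* z :+ u :+ (y :* z :+ v)) refl
    (a 0) (b 0) (c (suc n)) ((tail a *ₚ c) n) ((tail b *ₚ c) n)
  where open +-*-Solver

scale-*-at : ∀ r a b n → (scale r a *ₚ b) n ≡ r ℤ.* (a *ₚ b) n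
scale-*-at r a b zero = ℤₚ.*-assoc r (a 0) (b 0)
scale-*-at r a b (suc n)
  rewrite *ₚ-suc (scale r a) b n | *ₚ-suc a b n | scale-*-at r (tail a) b n =
  solve 4 (λ r x y u → r :* x :* y :+ r :* u := r :* (x :* y :+ u)) refl
    r (a 0) (b (suc n)) ((tail a *ₚ b) n)
  where open +-*-Solver

zeroˡ-at : ∀ a b → (∀ n → a n ≡ + 0) → ∀ n → (a *ₚ b) n ≡ + 0
zeroˡ-at a b h zero = cong (ℤ._* b 0) (h 0)
zeroˡ-at a b h (suc n) rewrite *ₚ-suc a b n | zeroˡ-at (tail a) b (h ∘ suc) n | h 0 = refl

assoc-at : ∀ a b c n → ((a *ₚ b) *ₚ c) n ≡ (a *ₚ (b *ₚ c)) n
assoc-at a b c zero = ℤₚ.*-assoc (a 0) (b 0) (c 0)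
assoc-at a b c (suc n)
  rewrite *ₚ-suc (a *ₚ b) c n | *ₚ-suc a (b *ₚ c) n | *ₚ-suc b c n
        | *ₚ-congˡ-at {tail (a *ₚ b)} {scale (a 0) (tail b) +ₚ tail a *ₚ b} c n (*ₚ-suc a b)
        | distribʳ-at (scale (a 0) (tail b)) (tail a *ₚ b) c n
        | scale-*-at (a 0) (tail b) c n | assoc-at (tail a) b c n =
  solve 5 (λ x y z u v → x :* y :* z :+ (x :* u :+ v) := x :* (y :* z :+ u) :+ v) refl
    (a 0) (b 0) (c (suc n)) ((tail b *ₚ c) n) ((tail a *ₚ (b *ₚ c)) n)
  where open +-*-Solver

-- Both factors have to lose their constant terms, one after the other, so the induction goes down
-- by two.
comm-at : ∀ a b n → (a *ₚ b) n ≡ (b *ₚ a) n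
comm-at a b zero = ℤₚ.*-comm (a 0) (b 0)
comm-at a b (suc zero) =
  solve 4 (λ x y z u → x :* u :+ y :* z := z :* y :+ u :* x) refl (a 0) (a 1) (b 0) (b 1)
  where open +-*-Solver
comm-at a b (suc (suc n)) = begin
  (a *ₚ b) (2 ℕ.+ n)
    ≡⟨ *ₚ-suc a b (suc n) ⟩
  a 0 ℤ.* b (2 ℕ.+ n) ℤ.+ (tail a *ₚ b) (suc n)
    ≡⟨ cong (λ z → a 0 ℤ.* b (2 ℕ.+ n) ℤ.+ z) (trans (comm-at (tail a) b (suc n)) (*ₚ-suc b (tail a) n)) ⟩
  a 0 ℤ.* b (2 ℕ.+ n) ℤ.+ (b 0 ℤ.* a (2 ℕ.+ n) ℤ.+ (tail b *ₚ tail a) n)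
    ≡⟨ cong (λ z → a 0 ℤ.* b (2 ℕ.+ n) ℤ.+ (b 0 ℤ.* a (2 ℕ.+ n) ℤ.+ z)) (comm-at (tail b) (tail a) n) ⟩
  a 0 ℤ.* b (2 ℕ.+ n) ℤ.+ (b 0 ℤ.* a (2 ℕ.+ n) ℤ.+ (tail a *ₚ tail b) n)
    ≡⟨ solve 3 (λ x y z → x :+ (y :+ z) := y :+ (x :+ z)) refl
         (a 0 ℤ.* b (2 ℕ.+ n)) (b 0 ℤ.* a (2 ℕ.+ n)) ((tail a *ₚ tail b) n) ⟩
  b 0 ℤ.* a (2 ℕ.+ n) ℤ.+ (a 0 ℤ.* b (2 ℕ.+ n) ℤ.+ (tail a *ₚ tail b) n)
    ≡⟨ cong (λ z → b 0 ℤ.* a (2 ℕ.+ n) ℤ.+ z) (trans (comm-at (tail b) a (suc n)) (*ₚ-suc a (tail b) n)) ⟨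
  b 0 ℤ.* a (2 ℕ.+ n) ℤ.+ (tail b *ₚ a) (suc n)
    ≡⟨ *ₚ-suc b a (suc n) ⟨
  (b *ₚ a) (2 ℕ.+ n) ∎
  where
  open +-*-Solver
  open ≡-Reasoning

const-*-at : ∀ r a n → (const r *ₚ a) n ≡ r ℤ.* a n
const-*-at r a zero    = refl
const-*-at r a (suc n)
  rewrite *ₚ-suc (const r) a n | zeroˡ-at (tail (const r)) a (λ _ → refl) n = ℤₚ.+-identityʳ _

0ₚ-at : ∀ n → 0ₚ n ≡ + 0
0ₚ-at zero    = refl
0ₚ-at (suc _) = refl

identityˡ : ∀ a → 1ₚ *ₚ a ≈ a
identityˡ a = mk≈ λ n → trans (const-*-at (+ 1) a n) (ℤₚ.*-identityˡ (a n))

distribʳ : ∀ c a b → (a +ₚ b) *ₚ c ≈ a *ₚ c +ₚ b *ₚ c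
distribʳ c a b = mk≈ (distribʳ-at a b c)

≈-refl : ∀ {a} → a ≈ a
≈-refl = mk≈ λ _ → refl

≈-sym : ∀ {a b} → a ≈ b → b ≈ a
≈-sym e = mk≈ λ n → sym (at e n)

≈-trans : ∀ {a b c} → a ≈ b → b ≈ c → a ≈ c
≈-trans e e′ = mk≈ λ n → trans (at e n) (at e′ n)

*ₚ-comm : ∀ a b → a *ₚ b ≈ b *ₚ a
*ₚ-comm a b = mk≈ (comm-at a b)

powerSeriesRing : CommutativeRing 0ℓ 0ℓ
powerSeriesRing = record
  { Carrier = PS ; _≈_ = _≈_ ; _+_ = _+ₚ_ ; _*_ = _*ₚ_ ; -_ = -ₚ_ ; 0# = 0ₚ ; 1# = 1ₚ
  ; isCommutativeRing = record
    { isRing = record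
      { +-isAbelianGroup = record
        { isGroup = record
          { isMonoid = record
            { isSemigroup = record
              { isMagma = record
                { isEquivalence = record { refl = ≈-refl ; sym = ≈-sym ; trans = ≈-trans }
                ; ∙-cong = λ e e′ → mk≈ λ n → cong₂ ℤ._+_ (at e n) (at e′ n)
                }
              ; assoc = λ a b c → mk≈ λ n → ℤₚ.+-assoc (a n) (b n) (c n)
              }
            ; identity = (λ a → mk≈ λ n → trans (cong (ℤ._+ a n) (0ₚ-at n)) (ℤₚ.+-identityˡ (a n)))
                       , (λ a → mk≈ λ n → trans (cong (λ z → a n ℤ.+ z) (0ₚ-at n)) (ℤₚ.+-identityʳ (a n)))
            }
          ; inverse = (λ a → mk≈ λ n → trans (ℤₚ.+-inverseˡ (a n)) (sym (0ₚ-at n)))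
                    , (λ a → mk≈ λ n → trans (ℤₚ.+-inverseʳ (a n)) (sym (0ₚ-at n)))
          ; ⁻¹-cong = λ e → mk≈ λ n → cong ℤ.-_ (at e n)
          }
        ; comm = λ a b → mk≈ λ n → ℤₚ.+-comm (a n) (b n)
        }
      ; *-cong = λ e e′ → mk≈ λ n → *ₚ-cong-≤ n (λ i _ → at e i) (λ i _ → at e′ i)
      ; *-assoc = λ a b c → mk≈ (assoc-at a b c)
      ; *-identity = identityˡ , (λ a → ≈-trans (*ₚ-comm a 1ₚ) (identityˡ a))
      ; distrib = (λ c a b → ≈-trans (*ₚ-comm c (a +ₚ b)) (≈-trans (distribʳ c a b)
                    (mk≈ λ n → cong₂ ℤ._+_ (comm-at a c n) (comm-at b c n))))
                , distribʳ
      }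
    ; *-comm = *ₚ-comm
    }
  }

const-+ : ∀ x y → const (x ℤ.+ y) ≈ const x +ₚ const y
const-+ x y = mk≈ λ { zero → refl ; (suc _) → refl }

const-* : ∀ x y → const (x ℤ.* y) ≈ const x *ₚ const y
const-* x y = mk≈ λ n → sym (trans (const-*-at x (const y) n) (scale-const n))
  where
  scale-const : ∀ n → x ℤ.* const y n ≡ const (x ℤ.* y) n
  scale-const zero    = refl
  scale-const (suc n) = ℤₚ.*-zeroʳ x

const-neg : ∀ x → const (ℤ.- x) ≈ -ₚ const x
const-neg x = mk≈ λ { zero → refl ; (suc _) → refl }

psAlgebra : IntegerAlgebra
psAlgebra = record
  { Carrier = PS ; _≈_ = _≈_ ; _+_ = _+ₚ_ ; _*_ = _*ₚ_ ; -_ = -ₚ_ ; ι = const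
  ; isCommutativeRing = CommutativeRing.isCommutativeRing powerSeriesRing
  ; ι-+ = const-+ ; ι-* = const-* ; ι-neg = const-neg
  }

open Algebraic psAlgebra
open ℛ using (solve; _:=_; _:+_; _:*_; _:-_; con)
open Exp (CommutativeRing.semiring powerSeriesRing) using (_^_)

*ₚ-cong : ∀ a b c d → a ≈ c → b ≈ d → a *ₚ b ≈ c *ₚ d
*ₚ-cong a b c d e e′ = mk≈ λ n → *ₚ-cong-≤ n (λ i _ → at e i) (λ i _ → at e′ i)

*ₚ-congˡ : ∀ a b c → b ≈ c → a *ₚ b ≈ a *ₚ c
*ₚ-congˡ a b c e = *ₚ-cong a b a c ≈-refl e

*ₚ-congʳ : ∀ a b c → a ≈ b → a *ₚ c ≈ b *ₚ c
*ₚ-congʳ a b c e = *ₚ-cong a c b c e ≈-refl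

+ₚ-cong : ∀ a b c d → a ≈ c → b ≈ d → a +ₚ b ≈ c +ₚ d
+ₚ-cong a b c d e e′ = mk≈ λ n → cong₂ ℤ._+_ (at e n) (at e′ n)

≡⇒≈ : ∀ {a b} → a ≡ b → a ≈ b
≡⇒≈ refl = ≈-refl

-- Congruence modulo q^N

≈⇒≈[] : ∀ {a b} N → a ≈ b → a ≈[ N ] b
≈⇒≈[] N e = mk≈[] λ n _ → at e n

≈[]-sym : ∀ {N a b} → a ≈[ N ] b → b ≈[ N ] a
≈[]-sym e = mk≈[] λ n n<N → sym (at< e n n<N)

≈[]-trans : ∀ {N a b c} → a ≈[ N ] b → b ≈[ N ] c → a ≈[ N ] c
≈[]-trans e e′ = mk≈[] λ n n<N → trans (at< e n n<N) (at< e′ n n<N)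

≈[]-mono : ∀ {M N a b} → M ℕ.≤ N → a ≈[ N ] b → a ≈[ M ] b
≈[]-mono M≤N e = mk≈[] λ n n<M → at< e n (ℕₚ.<-≤-trans n<M M≤N)

+-cong[] : ∀ {N} a b c d → a ≈[ N ] c → b ≈[ N ] d → a +ₚ b ≈[ N ] c +ₚ d
+-cong[] a b c d e e′ = mk≈[] λ n n<N → cong₂ ℤ._+_ (at< e n n<N) (at< e′ n n<N)

-ₚ-cong[] : ∀ {N} a b c d → a ≈[ N ] c → b ≈[ N ] d → a -ₚ b ≈[ N ] c -ₚ d
-ₚ-cong[] a b c d e e′ = mk≈[] λ n n<N → cong₂ ℤ._-_ (at< e n n<N) (at< e′ n n<N)

*-cong[] : ∀ {N} a b c d → a ≈[ N ] c → b ≈[ N ] d → a *ₚ b ≈[ N ] c *ₚ d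
*-cong[] a b c d e e′ = mk≈[] λ n n<N →
  *ₚ-cong-≤ n (λ i i≤n → at< e i (ℕₚ.≤-<-trans i≤n n<N)) (λ i i≤n → at< e′ i (ℕₚ.≤-<-trans i≤n n<N))

*-congˡ[] : ∀ {N} a b c → b ≈[ N ] c → a *ₚ b ≈[ N ] a *ₚ c
*-congˡ[] a b c e = *-cong[] a b a c (≈⇒≈[] _ ≈-refl) e

*-congʳ[] : ∀ {N} a b c → a ≈[ N ] b → a *ₚ c ≈[ N ] b *ₚ c
*-congʳ[] a b c e = *-cong[] a c b c e (≈⇒≈[] _ ≈-refl)

-- A factor without constant term shifts the other one up by at least one degree. This gain drives
-- the uniqueness argument `T≈D`.
*-raise : ∀ {N} u a b → u 0 ≡ + 0 → a ≈[ N ] b → u *ₚ a ≈[ suc N ] u *ₚ b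
*-raise {N} u a b u0 e = mk≈[] go
  where
  go : ∀ n → n ℕ.< suc N → (u *ₚ a) n ≡ (u *ₚ b) n
  go zero    _         = trans (cong (ℤ._* a 0) u0) (cong (ℤ._* b 0) (sym u0))
  go (suc n) (s≤s n<N) = begin
    (u *ₚ a) (suc n)                             ≡⟨ *ₚ-suc u a n ⟩
    u 0 ℤ.* a (suc n) ℤ.+ (tail u *ₚ a) n        ≡⟨ cong₂ ℤ._+_ (trans (cong (ℤ._* a (suc n)) u0) (cong (ℤ._* b (suc n)) (sym u0)))
                                                      (at< (*-congˡ[] (tail u) a b e) n n<N) ⟩
    u 0 ℤ.* b (suc n) ℤ.+ (tail u *ₚ b) n        ≡⟨ *ₚ-suc u b n ⟨
    (u *ₚ b) (suc n)                             ∎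
    where open ≡-Reasoning

*0ₚ : ∀ a → a *ₚ 0ₚ ≈ 0ₚ
*0ₚ a = CommutativeRing.zeroʳ powerSeriesRing a

*-vanishˡ : ∀ {N} a b → a ≈[ N ] 0ₚ → a *ₚ b ≈[ N ] 0ₚ
*-vanishˡ a b e = ≈[]-trans (*-congʳ[] a 0ₚ b e) (≈⇒≈[] _ (CommutativeRing.zeroˡ powerSeriesRing b))

*-vanishʳ : ∀ {N} a b → b ≈[ N ] 0ₚ → a *ₚ b ≈[ N ] 0ₚ
*-vanishʳ a b e = ≈[]-trans (*-congˡ[] a b 0ₚ e) (≈⇒≈[] _ (*0ₚ a))

^-vanish : ∀ u → u 0 ≡ + 0 → ∀ m → u ^ₚ m ≈[ m ] 0ₚ
^-vanish u u0 zero    = mk≈[] λ _ ()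
^-vanish u u0 (suc m) = ≈[]-trans (*-raise u (u ^ₚ m) 0ₚ u0 (^-vanish u u0 m)) (≈⇒≈[] _ (*0ₚ u))

-- Sums and reciprocals of series

Sum-at : ∀ n F N → Sum (suc n) F N ≡ sumUpTo n (λ i → F i N)
Sum-at zero    F N = trans (cong (ℤ._+ F 0 N) (0ₚ-at N)) (ℤₚ.+-identityˡ (F 0 N))
Sum-at (suc n) F N = cong (ℤ._+ F (suc n) N) (Sum-at n F N)

Sum-extend : ∀ {N} F → (∀ i → N ℕ.≤ i → F i ≈[ N ] 0ₚ) → ∀ d → Sum (d ℕ.+ N) F ≈[ N ] Sum N F
Sum-extend {N} F h zero    = ≈⇒≈[] N ≈-refl
Sum-extend {N} F h (suc d) = ≈[]-trans
  (+-cong[] (Sum (d ℕ.+ N) F) (F (d ℕ.+ N)) (Sum N F) 0ₚ (Sum-extend F h d) (h (d ℕ.+ N) (ℕₚ.m≤n+m N d)))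
  (≈⇒≈[] N (CommutativeRing.+-identityʳ powerSeriesRing (Sum N F)))

-- `qsum` stops at an index that depends on the coefficient being read; the order condition permits
-- one cut-off for all coefficients below `N`.
qsum≈Sum : ∀ F → (∀ i → F i ≈[ i ] 0ₚ) → ∀ {N m} → N ℕ.≤ m → qsum F ≈[ N ] Sum m F
qsum≈Sum F h {N} {m} N≤m = mk≈[] λ n n<N → begin
  sumUpTo n (λ i → F i n)           ≡⟨ Sum-at n F n ⟨
  Sum (suc n) F n                   ≡⟨ at< (Sum-extend F (λ i n<i → ≈[]-mono n<i (h i)) (m ∸ suc n)) n ℕₚ.≤-refl ⟨
  Sum (m ∸ suc n ℕ.+ suc n) F n     ≡⟨ cong (λ z → Sum z F n) (ℕₚ.m∸n+n≡m (ℕₚ.≤-trans n<N N≤m)) ⟩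
  Sum m F n                         ∎
  where open ≡-Reasoning

geometric : ∀ u m → (1ₚ -ₚ u) *ₚ Sum m (u ^ₚ_) ≈ 1ₚ -ₚ u ^ₚ m
geometric u zero    = solve 1 (λ u → (con (+ 1) :- u) :* con (+ 0) := con (+ 1) :- con (+ 1)) ≈-refl u
geometric u (suc m) = ≈-trans
  (solve 3 (λ u s p → (con (+ 1) :- u) :* (s :+ p) := (con (+ 1) :- u) :* s :+ (p :- u :* p)) ≈-refl u (Sum m (u ^ₚ_)) (u ^ₚ m))
  (≈-trans (+ₚ-cong _ _ _ _ (geometric u m) (≈-refl {u ^ₚ m -ₚ u *ₚ u ^ₚ m}))
    (solve 2 (λ p q → con (+ 1) :- p :+ (p :- q) := con (+ 1) :- q) ≈-refl (u ^ₚ m) (u *ₚ u ^ₚ m)))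

-- Modulo `q^N` the reciprocal is a finite geometric sum in `u = 1 - a`, and its defect `u^N`
-- vanishes there.
recip-inverse : ∀ a → a 0 ≡ + 1 → a *ₚ recip a ≈ 1ₚ
recip-inverse a a0 = mk≈ λ n → at< (mod (suc n)) n ℕₚ.≤-refl
  where
  u = 1ₚ -ₚ a
  u0 : u 0 ≡ + 0
  u0 = cong (λ z → + 1 ℤ.- z) a0
  mod : ∀ N → a *ₚ recip a ≈[ N ] 1ₚ
  mod N = ≈[]-trans (*-congˡ[] a (recip a) (Sum N (u ^ₚ_)) (qsum≈Sum (u ^ₚ_) (^-vanish u u0) ℕₚ.≤-refl))
    (≈[]-trans (≈⇒≈[] N (*ₚ-congʳ a (1ₚ -ₚ u) (Sum N (u ^ₚ_))
        (solve 1 (λ a → a := con (+ 1) :- (con (+ 1) :- a)) ≈-refl a)))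
    (≈[]-trans (≈⇒≈[] N (geometric u N))
    (≈[]-trans (-ₚ-cong[] 1ₚ (u ^ₚ N) 1ₚ 0ₚ (≈⇒≈[] N ≈-refl) (^-vanish u u0 N))
      (≈⇒≈[] N (solve 0 (con (+ 1) :- con (+ 0) := con (+ 1)) ≈-refl)))))

cancel[] : ∀ {N} a x y → a 0 ≡ + 1 → a *ₚ x ≈[ N ] a *ₚ y → x ≈[ N ] y
cancel[] {N} a x y a0 e = ≈[]-trans (≈⇒≈[] N (undo x))
  (≈[]-trans (*-congˡ[] (recip a) (a *ₚ x) (a *ₚ y) e) (≈⇒≈[] N (≈-sym (undo y))))
  where
  undo : ∀ x → x ≈ recip a *ₚ (a *ₚ x)
  undo x = ≈-trans (solve 1 (λ x → x := con (+ 1) :* x) ≈-refl x)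
    (≈-trans (*ₚ-congʳ 1ₚ (a *ₚ recip a) x (≈-sym (recip-inverse a a0)))
      (solve 3 (λ a r x → a :* r :* x := r :* (a :* x)) ≈-refl a (recip a) x))

cancel : ∀ a x y → a 0 ≡ + 1 → a *ₚ x ≈ a *ₚ y → x ≈ y
cancel a x y a0 e = mk≈ λ n → at< (cancel[] a x y a0 (≈⇒≈[] (suc n) e)) n ℕₚ.≤-refl

-- Monomials

scale≈const* : ∀ r a → scale r a ≈ const r *ₚ a
scale≈const* r a = mk≈ λ n → sym (const-*-at r a n)

X^0≈1 : X^ 0 ≈ 1ₚ
X^0≈1 = mk≈ λ { zero → refl ; (suc n) → refl }

X^-+ : ∀ m n → X^ (m ℕ.+ n) ≈ X^ m *ₚ X^ n
X^-+ m n = mk≈ (go m)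
  where
  go : ∀ m i → X^ (m ℕ.+ n) i ≡ (X^ m *ₚ X^ n) i
  go zero    i       = trans (sym (at (identityˡ (X^ n)) i)) (at (*ₚ-congʳ 1ₚ (X^ 0) (X^ n) (≈-sym X^0≈1)) i)
  go (suc m) zero    = refl
  go (suc m) (suc i) = trans (go m i) (sym (trans (*ₚ-suc (X^ (suc m)) (X^ n) i) (ℤₚ.+-identityˡ _)))

X^-^ : ∀ e m → X^ e ^ₚ m ≈ X^ (e ℕ.* m)
X^-^ e zero    = ≈-trans (≈-sym X^0≈1) (≡⇒≈ (cong X^ (sym (ℕₚ.*-zeroʳ e))))
X^-^ e (suc m) = ≈-trans (*ₚ-congˡ (X^ e) (X^ e ^ₚ m) (X^ (e ℕ.* m)) (X^-^ e m))
  (≈-trans (≈-sym (X^-+ e (e ℕ.* m))) (≡⇒≈ (cong X^ (sym (ℕₚ.*-suc e m)))))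

X^-vanish : ∀ e → X^ e ≈[ e ] 0ₚ
X^-vanish e = mk≈[] (go e)
  where
  go : ∀ e n → n ℕ.< e → X^ e n ≡ 0ₚ n
  go (suc e) zero    _         = refl
  go (suc e) (suc n) (s≤s n<e) = trans (go e n n<e) (0ₚ-at n)

^≡^ₚ : ∀ a n → a ^ n ≡ a ^ₚ n
^≡^ₚ a zero    = refl
^≡^ₚ a (suc n) = cong (a *ₚ_) (^≡^ₚ a n)

^ₚ-+ : ∀ a m n → a ^ₚ (m ℕ.+ n) ≈ a ^ₚ m *ₚ a ^ₚ n
^ₚ-+ a zero    n = ≈-sym (identityˡ (a ^ₚ n))
^ₚ-+ a (suc m) n = ≈-trans (*ₚ-congˡ a (a ^ₚ (m ℕ.+ n)) (a ^ₚ m *ₚ a ^ₚ n) (^ₚ-+ a m n))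
  (solve 3 (λ x y z → x :* (y :* z) := x :* y :* z) ≈-refl a (a ^ₚ m) (a ^ₚ n))

1-ₚ-at0 : ∀ u → u 0 ≡ + 0 → (1ₚ -ₚ u) 0 ≡ + 1
1-ₚ-at0 u u0 = cong (λ z → + 1 ℤ.- z) u0

*ₚ-at0 : ∀ a b → a 0 ≡ + 1 → b 0 ≡ + 1 → (a *ₚ b) 0 ≡ + 1
*ₚ-at0 a b a0 b0 = cong₂ ℤ._*_ a0 b0

*ₚ-zero-at0 : ∀ a b → a 0 ≡ + 0 → (a *ₚ b) 0 ≡ + 0
*ₚ-zero-at0 a b a0 = cong (ℤ._* b 0) a0

-- Stabilisation of infinite products and chain sums

Sum-cong[] : ∀ {N} n f g → (∀ i → i ℕ.< n → f i ≈[ N ] g i) → Sum n f ≈[ N ] Sum n g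
Sum-cong[] zero    f g h = ≈⇒≈[] _ ≈-refl
Sum-cong[] (suc n) f g h = +-cong[] (Sum n f) (f n) (Sum n g) (g n)
  (Sum-cong[] n f g (λ i i<n → h i (ℕₚ.m<n⇒m<1+n i<n))) (h n ℕₚ.≤-refl)

neighbours-cong[] : ∀ {N} k F G → (∀ k → F k ≈[ N ] G k) → neighbours k F ≈[ N ] neighbours k G
neighbours-cong[] zero    F G h = +-cong[] (F 1) (F 1) (G 1) (G 1) (h 1) (h 1)
neighbours-cong[] (suc k) F G h = +-cong[] (F k) (F (2 ℕ.+ k)) (G k) (G (2 ℕ.+ k)) (h k) (h (2 ℕ.+ k))

poch-at0 : ∀ a b → a 0 ≡ + 0 → ∀ m → poch a b m 0 ≡ + 1
poch-at0 a b a0 zero    = refl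
poch-at0 a b a0 (suc m) = *ₚ-at0 (poch a b m) (1ₚ -ₚ a *ₚ b ^ₚ m) (poch-at0 a b a0 m)
  (1-ₚ-at0 (a *ₚ b ^ₚ m) (*ₚ-zero-at0 a (b ^ₚ m) a0))

-- The factor `1 - a b^r` is 1 modulo `q^(r+1)`, as `a` and `b` both lack a constant term; the
-- factors with `r ≥ m` are therefore invisible modulo `q^(m+1)`.
poch-extend : ∀ a b → a 0 ≡ + 0 → b 0 ≡ + 0 → ∀ d m → poch a b (d ℕ.+ m) ≈[ suc m ] poch a b m
poch-extend a b a0 b0 zero    m = ≈⇒≈[] _ ≈-refl
poch-extend a b a0 b0 (suc d) m = ≈[]-trans
  (*-cong[] (poch a b (d ℕ.+ m)) (1ₚ -ₚ a *ₚ b ^ₚ (d ℕ.+ m)) (poch a b m) 1ₚ (poch-extend a b a0 b0 d m)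
    (≈[]-trans (-ₚ-cong[] 1ₚ (a *ₚ b ^ₚ (d ℕ.+ m)) 1ₚ 0ₚ (≈⇒≈[] _ ≈-refl)
        (≈[]-mono (s≤s (ℕₚ.m≤n+m m d)) (≈[]-trans
          (*-raise a (b ^ₚ (d ℕ.+ m)) 0ₚ a0 (^-vanish b b0 (d ℕ.+ m))) (≈⇒≈[] _ (*0ₚ a)))))
      (≈⇒≈[] _ (solve 0 (con (+ 1) :- con (+ 0) := con (+ 1)) ≈-refl))))
  (≈⇒≈[] _ (solve 1 (λ x → x :* con (+ 1) := x) ≈-refl (poch a b m)))

poch≈pochInf : ∀ a b → a 0 ≡ + 0 → b 0 ≡ + 0 → ∀ {N m} → N ℕ.≤ m → poch a b m ≈[ N ] pochInf a b
poch≈pochInf a b a0 b0 {N} {m} N≤m = mk≈[] λ n n<N → trans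
  (cong (λ z → poch a b z n) (sym (ℕₚ.m∸n+n≡m (ℕₚ.≤-trans n<N N≤m))))
  (at< (poch-extend a b a0 b0 (m ∸ suc n) (suc n)) n (ℕₚ.m<n⇒m<1+n ℕₚ.≤-refl))

chainSum-extend : ∀ f → (∀ m → f (suc m) ≈[ suc m ] 0ₚ) → ∀ j d n →
  chainSum f j (d ℕ.+ n) ≈[ suc n ] chainSum f j n
chainSum-extend f fv zero    d       n = ≈⇒≈[] _ ≈-refl
chainSum-extend f fv (suc j) zero    n = ≈⇒≈[] _ ≈-refl
chainSum-extend f fv (suc j) (suc d) n = ≈[]-trans
  (+-cong[] (chainSum f (suc j) (d ℕ.+ n)) (f (suc (d ℕ.+ n)) *ₚ chainSum f j (suc (d ℕ.+ n))) (chainSum f (suc j) n) 0ₚ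
    (chainSum-extend f fv (suc j) d n)
    (*-vanishˡ (f (suc (d ℕ.+ n))) (chainSum f j (suc (d ℕ.+ n))) (≈[]-mono (s≤s (ℕₚ.m≤n+m n d)) (fv (d ℕ.+ n)))))
  (≈⇒≈[] _ (CommutativeRing.+-identityʳ powerSeriesRing (chainSum f (suc j) n)))

-- 1/(p;p)_(n-1), with the convention 1/(p;p)_(-1) = 0
recipPoch : PS → ℕ → PS
recipPoch p zero    = 0ₚ
recipPoch p (suc n) = recip (poch p p n)

module _ (p : PS) (p0 : p 0 ≡ + 0) where

  1-p^-at0 : ∀ n → (1ₚ -ₚ p ^ₚ suc n) 0 ≡ + 1
  1-p^-at0 n = 1-ₚ-at0 (p ^ₚ suc n) (*ₚ-zero-at0 p (p ^ₚ n) p0)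

  recipPoch-one : recipPoch p 1 ≈ 1ₚ
  recipPoch-one = ≈-trans (≈-sym (identityˡ (recip 1ₚ))) (recip-inverse 1ₚ refl)

  recipPoch-step : ∀ n → recipPoch p n ≈ (1ₚ -ₚ p ^ₚ n) *ₚ recipPoch p (suc n)
  recipPoch-step zero    = solve 1 (λ x → con (+ 0) := (con (+ 1) :- con (+ 1)) :* x) ≈-refl (recipPoch p 1)
  recipPoch-step (suc n) = cancel Q (recip Q) (u *ₚ recip (Q *ₚ u)) Q0
    (≈-trans (recip-inverse Q Q0) (≈-trans (≈-sym (recip-inverse (Q *ₚ u) (*ₚ-at0 Q u Q0 (1-p^-at0 n))))
      (solve 3 (λ a b c → a :* b :* c := a :* (b :* c)) ≈-refl Q u (recip (Q *ₚ u)))))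
    where
    Q = poch p p n
    u = 1ₚ -ₚ p ^ₚ suc n
    Q0 : Q 0 ≡ + 1
    Q0 = poch-at0 p p p0 n

  recipPoch-limit : ∀ {N n} → N ℕ.< n → recipPoch p n ≈[ N ] recip (pochInf p p)
  recipPoch-limit {N} {suc n} (s≤s N≤n) = cancel[] Q (recip Q) (recip Q∞) (poch-at0 p p p0 n)
    (≈[]-trans (≈⇒≈[] N (≈-trans (recip-inverse Q (poch-at0 p p p0 n)) (≈-sym (recip-inverse Q∞ (poch-at0 p p p0 1)))))
      (*-congʳ[] Q∞ Q (recip Q∞) (≈[]-sym (poch≈pochInf p p p0 p0 N≤n))))
    where
    Q = poch p p n
    Q∞ = pochInf p p

-- The limit m → ∞

module Limit
  (p : PS) (p0 : p 0 ≡ + 0) (b : ℕ) (X² : X *ₚ X ≈ p ^ₚ b)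
  (w : ℕ → PS)
  (w-zero : w 0 *ₚ recipPoch p b ≈ 1ₚ)
  (w-step : ∀ i → (1ₚ -ₚ p ^ₚ suc i) *ₚ w (suc i) ≈ (1ₚ -ₚ p ^ₚ (i ℕ.+ b)) *ₚ w i)
  (ε : ℤ) (ε² : ε ℤ.* ε ≡ + 1)
  (f : ℕ → PS)
  (f-vanish : ∀ m → f (suc m) ≈[ suc m ] 0ₚ)
  (f-clear : ∀ M → (1ₚ -ₚ const ε *ₚ (p ^ₚ M *ₚ X)) *ₚ (1ₚ -ₚ const ε *ₚ (p ^ₚ M *ₚ X)) *ₚ f (suc M) ≈ p ^ₚ M *ₚ X)
  where

  1-p^-cancel : ∀ n x → (1ₚ -ₚ p ^ₚ suc n) *ₚ x ≈ 0ₚ → x ≈ 0ₚ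
  1-p^-cancel n x e = cancel (1ₚ -ₚ p ^ₚ suc n) x 0ₚ (1-p^-at0 p p0 n) (≈-trans e (≈-sym (*0ₚ (1ₚ -ₚ p ^ₚ suc n))))

  constε² : const ε *ₚ const ε ≈ 1ₚ
  constε² = ≈-trans (≈-sym (const-* ε ε)) (≡⇒≈ (cong const ε²))

  open PartialFractions (p ^ₚ_) X b w (recipPoch p) ≈-refl (^ₚ-+ p) X²
    (recipPoch-one p p0) (recipPoch-step p p0) w-zero w-step 1-p^-cancel public

  open ChainRecurrence ε y f (chainSum f) (λ _ → ≈-refl) (λ _ → ≈-refl) (λ _ _ → ≈-refl) f-clear

  P′ : ℕ → PS
  P′ = P (const ε) constε²

  D′ : ℕ → ℕ → PS
  D′ = D (const ε) constε²

  y-at0 : ∀ M → y M 0 ≡ + 0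
  y-at0 M = ℤₚ.*-zeroʳ ((p ^ₚ M) 0)

  -- The factor y M in both recurrences gains one power of q, at the cost of one summand of T.
  T≈D : ∀ m N L k → N ℕ.≤ L → T L k m ≈[ N ] D′ k m
  T≈D m       zero    L       k _         = mk≈[] λ _ ()
  T≈D zero    (suc N) (suc L) k _         = ≈⇒≈[] _ (≈-trans (T-zero L k) (≈-sym (D-zero (const ε) constε² k)))
  T≈D (suc M) (suc N) (suc L) k (s≤s N≤L) = cancel[] s (T (suc L) k (suc M)) (D′ k (suc M)) s0
    (≈[]-trans (≈⇒≈[] _ (T-rec L k M))
    (≈[]-trans
      (+-cong[] (s *ₚ T (suc L) k M) (y M *ₚ U) (s *ₚ D′ k M) (y M *ₚ U′)
        (*-congˡ[] s (T (suc L) k M) (D′ k M) (T≈D M (suc N) (suc L) k (s≤s N≤L)))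
        (*-raise (y M) U U′ (y-at0 M)
          (-ₚ-cong[] (neighbours k (λ k′ → T L k′ (suc M))) (2ε *ₚ T L k (suc M))
                    (neighbours k (λ k′ → D′ k′ (suc M))) (2ε *ₚ D′ k (suc M))
            (neighbours-cong[] k (λ k′ → T L k′ (suc M)) (λ k′ → D′ k′ (suc M)) (λ k′ → T≈D (suc M) N L k′ N≤L))
            (*-congˡ[] 2ε (T L k (suc M)) (D′ k (suc M)) (T≈D (suc M) N L k N≤L)))))
      (≈⇒≈[] _ (≈-sym (D-rec (const ε) constε² k M)))))
    where
    v = 1ₚ -ₚ const ε *ₚ y M
    s = v *ₚ v
    2ε = const ε +ₚ const ε
    U = neighbours k (λ k′ → T L k′ (suc M)) -ₚ 2ε *ₚ T L k (suc M)
    U′ = neighbours k (λ k′ → D′ k′ (suc M)) -ₚ 2ε *ₚ D′ k (suc M)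
    v0 : v 0 ≡ + 1
    v0 = 1-ₚ-at0 (const ε *ₚ y M) (trans (cong (λ z → ε ℤ.* z) (y-at0 M)) (ℤₚ.*-zeroʳ ε))
    s0 : s 0 ≡ + 1
    s0 = *ₚ-at0 v v v0 v0

  transform : ℕ → PS
  transform k = qsum (λ i → scale ((ℤ.- ε) ℤ.^ i ℤ.* + ((2 ℕ.* (k ℕ.+ i)) C i)) (chainSumInf f (k ℕ.+ i)))

  -- Coefficient `n` involves only `j = k + i` with `i ≤ n`, and there a chain sum cut at `n` agrees
  -- with one cut at `m`. The indices `j < k`, absent on the left, contribute zero to `T`.
  transform≡T : ∀ k n m → n ℕ.≤ m → transform k n ≡ T (k ℕ.+ suc n) k m n
  transform≡T k n m n≤m = begin
    sumUpTo n (λ i → (ℤ.- ε) ℤ.^ i ℤ.* + ((2 ℕ.* (k ℕ.+ i)) C i) ℤ.* chainSum f (k ℕ.+ i) n n)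
      ≡⟨ sumUpTo-cong n (λ i _ → term i) ⟩
    sumUpTo n (λ i → F (k ℕ.+ i) n)
      ≡⟨ Sum-at n (λ i → F (k ℕ.+ i)) n ⟨
    Sum (suc n) (λ i → F (k ℕ.+ i)) n
      ≡⟨ at (Sum-drop k (suc n) F small) n ⟨
    Sum (k ℕ.+ suc n) F n ∎
    where
    open ≡-Reasoning
    F : ℕ → PS
    F j = const (centralCoeff ε k j) *ₚ chainSum f j m
    small : ∀ j → j ℕ.< k → F j ≈ 0ₚ
    small j j<k = ≈-trans (*ₚ-congʳ (const (centralCoeff ε k j)) 0ₚ (chainSum f j m) (≡⇒≈ (cong const (centralCoeff-< ε k j j<k))))
      (CommutativeRing.zeroˡ powerSeriesRing (chainSum f j m))
    term : ∀ i → (ℤ.- ε) ℤ.^ i ℤ.* + ((2 ℕ.* (k ℕ.+ i)) C i) ℤ.* chainSum f (k ℕ.+ i) n n ≡ F (k ℕ.+ i) n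
    term i = begin
      (ℤ.- ε) ℤ.^ i ℤ.* + ((2 ℕ.* (k ℕ.+ i)) C i) ℤ.* chainSum f (k ℕ.+ i) n n
        ≡⟨ cong₂ ℤ._*_ (sym (centralCoeff≡C ε ε² k i))
             (trans (sym (at< (chainSum-extend f f-vanish (k ℕ.+ i) (m ∸ n) n) n ℕₚ.≤-refl))
               (cong (λ z → chainSum f (k ℕ.+ i) z n) (ℕₚ.m∸n+n≡m n≤m))) ⟩
      centralCoeff ε k (k ℕ.+ i) ℤ.* chainSum f (k ℕ.+ i) m n
        ≡⟨ const-*-at (centralCoeff ε k (k ℕ.+ i)) (chainSum f (k ℕ.+ i) m) n ⟨
      F (k ℕ.+ i) n ∎

  transform≈D : ∀ k {N m} → N ℕ.≤ m → transform k ≈[ N ] D′ k m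
  transform≈D k {N} {m} N≤m = mk≈[] λ n n<N → trans
    (transform≡T k n m (ℕₚ.≤-trans (ℕₚ.<⇒≤ n<N) N≤m))
    (at< (T≈D m (suc n) (k ℕ.+ suc n) k (ℕₚ.m≤n+m (suc n) k)) n ℕₚ.≤-refl)

  P∞ Q∞ : PS
  P∞ = pochInf (scale ε X) p
  Q∞ = pochInf p p

  P≈poch : ∀ m → P′ m ≈ poch (scale ε X) p m
  P≈poch zero    = ≈-refl
  P≈poch (suc m) = *ₚ-cong (P′ m) (1ₚ -ₚ const ε *ₚ y m) (poch (scale ε X) p m) (1ₚ -ₚ scale ε X *ₚ p ^ₚ m) (P≈poch m)
    (≈-trans (solve 3 (λ e a x → con (+ 1) :- e :* (a :* x) := con (+ 1) :- e :* x :* a) ≈-refl (const ε) (p ^ₚ m) X)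
      (mk≈ λ n → cong (λ z → 1ₚ n ℤ.- z) (at (*ₚ-congʳ (const ε *ₚ X) (scale ε X) (p ^ₚ m) (≈-sym (scale≈const* ε X))) n)))

  P-limit : ∀ {N m} → N ℕ.≤ m → P′ m ≈[ N ] P∞
  P-limit {N} {m} N≤m = ≈[]-trans (≈⇒≈[] N (P≈poch m))
    (poch≈pochInf (scale ε X) p (ℤₚ.*-zeroʳ ε) p0 N≤m)

  g-vanish : ∀ i → g i ≈[ i ] 0ₚ
  g-vanish i = *-vanishˡ (sg i *ₚ τ (suc i)) (w i) (*-vanishʳ (sg i) (τ (suc i)) (*-vanishʳ (τ i) (p ^ₚ i) (^-vanish p p0 i)))

  series : ℕ → ℕ → PS
  series k i = g i *ₚ y i ^ₚ k

  transform-limit : ∀ k N → transform k ≈[ N ] P∞ ^ₚ 2 *ₚ recip (Q∞ ^ₚ 2) *ₚ Sum (suc (N ℕ.+ N)) (series k)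
  transform-limit k N = ≈[]-trans (transform≈D k N≤m)
    (≈[]-trans (*-cong[] (P′ m *ₚ P′ m) (B k m) (P∞ *ₚ P∞) (r *ₚ r *ₚ Sum m (series k))
        (*-cong[] (P′ m) (P′ m) P∞ P∞ (P-limit N≤m) (P-limit N≤m))
        (≈[]-trans (Sum-cong[] m (λ i → c m i *ₚ y i ^ k) (λ i → r *ₚ r *ₚ series k i) (λ i _ → term i))
          (≈⇒≈[] N (≈-sym (Sum-*ˡ m (r *ₚ r) (series k))))))
    (≈⇒≈[] N (≈-trans
      (solve 3 (λ a s t → a :* a :* (s :* t) := a :* (a :* con (+ 1)) :* s :* t) ≈-refl P∞ (r *ₚ r) (Sum m (series k)))
      (*ₚ-congʳ (P∞ ^ₚ 2 *ₚ (r *ₚ r)) (P∞ ^ₚ 2 *ₚ recip (Q∞ ^ₚ 2)) (Sum m (series k))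
        (*ₚ-congˡ (P∞ ^ₚ 2) (r *ₚ r) (recip (Q∞ ^ₚ 2)) r²)))))
    where
    -- With `2N + 1` nodes, `m ∸ i` exceeds `N` for all `i < N`, so both `K` factors have reached
    -- `1/(p;p)_∞` modulo `q^N`; for `i ≥ N` the factor `g i` vanishes modulo `q^N`.
    m = suc (N ℕ.+ N)
    r = recip Q∞
    N≤m : N ℕ.≤ m
    N≤m = ℕₚ.m≤n⇒m≤1+n (ℕₚ.m≤m+n N N)
    Q0 : Q∞ 0 ≡ + 1
    Q0 = poch-at0 p p p0 1
    Q²0 : (Q∞ ^ₚ 2) 0 ≡ + 1
    Q²0 = *ₚ-at0 Q∞ (Q∞ ^ₚ 1) Q0 (*ₚ-at0 Q∞ 1ₚ Q0 refl)
    r² : r *ₚ r ≈ recip (Q∞ ^ₚ 2)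
    r² = cancel (Q∞ ^ₚ 2) (r *ₚ r) (recip (Q∞ ^ₚ 2)) Q²0
      (≈-trans (solve 2 (λ q r → q :* (q :* con (+ 1)) :* (r :* r) := q :* r :* (q :* r)) ≈-refl Q∞ r)
      (≈-trans (*ₚ-cong (Q∞ *ₚ r) (Q∞ *ₚ r) 1ₚ 1ₚ (recip-inverse Q∞ Q0) (recip-inverse Q∞ Q0))
      (≈-trans (identityˡ 1ₚ) (≈-sym (recip-inverse (Q∞ ^ₚ 2) Q²0)))))
    term : ∀ i → c m i *ₚ y i ^ k ≈[ N ] r *ₚ r *ₚ series k i
    term i rewrite ^≡^ₚ (y i) k with i ℕ.<? N
    ... | yes i<N = ≈[]-trans
      (*-congʳ[] (c m i) (g i *ₚ r *ₚ r) Y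
        (*-cong[] (g i *ₚ K₁) K₂ (g i *ₚ r) r
          (*-congˡ[] (g i) K₁ r (recipPoch-limit p p0 large₁))
          (recipPoch-limit p p0 large₂)))
      (≈⇒≈[] N (solve 3 (λ g r y → g :* r :* r :* y := r :* r :* (g :* y)) ≈-refl (g i) r Y))
      where
      Y = y i ^ₚ k
      K₁ = recipPoch p (m ∸ i)
      K₂ = recipPoch p (m ℕ.+ i ℕ.+ b)
      large₁ : N ℕ.< m ∸ i
      large₁ = ℕₚ.≤-trans (ℕₚ.≤-reflexive (sym (ℕₚ.m+n∸n≡m (suc N) N))) (ℕₚ.∸-monoʳ-≤ m (ℕₚ.<⇒≤ i<N))
      large₂ : N ℕ.< m ℕ.+ i ℕ.+ b
      large₂ = s≤s (ℕₚ.≤-trans (ℕₚ.m≤m+n N N) (ℕₚ.≤-trans (ℕₚ.m≤m+n (N ℕ.+ N) i) (ℕₚ.m≤m+n (N ℕ.+ N ℕ.+ i) b)))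
    ... | no i≮N = ≈[]-trans
      (*-vanishˡ (c m i) (y i ^ₚ k) (*-vanishˡ (g i *ₚ K₁) K₂ (*-vanishˡ (g i) K₁ gᵢ)))
      (≈[]-sym (*-vanishʳ (r *ₚ r) (series k i) (*-vanishˡ (g i) (y i ^ₚ k) gᵢ)))
      where
      K₁ = recipPoch p (m ∸ i)
      K₂ = recipPoch p (m ℕ.+ i ℕ.+ b)
      gᵢ : g i ≈[ N ] 0ₚ
      gᵢ = ≈[]-mono (ℕₚ.≮⇒≥ i≮N) (g-vanish i)

-- Exponents, monomials and chain terms

triangle : ℕ → ℕ
triangle zero    = 0
triangle (suc n) = triangle n ℕ.+ suc n

n[n+1]≡2triangle : ∀ n → n ℕ.* suc n ≡ triangle n ℕ.* 2
n[n+1]≡2triangle zero    = refl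
n[n+1]≡2triangle (suc n) = begin
  suc n ℕ.* suc (suc n)                  ≡⟨ S.solve 1 (λ n → (S.con 1 S.:+ n) S.:* (S.con 2 S.:+ n) S.:= n S.:* (S.con 1 S.:+ n) S.:+ (S.con 1 S.:+ n) S.:* S.con 2) refl n ⟩
  n ℕ.* suc n ℕ.+ suc n ℕ.* 2            ≡⟨ cong (ℕ._+ suc n ℕ.* 2) (n[n+1]≡2triangle n) ⟩
  triangle n ℕ.* 2 ℕ.+ suc n ℕ.* 2       ≡⟨ ℕₚ.*-distribʳ-+ 2 (triangle n) (suc n) ⟨
  triangle (suc n) ℕ.* 2                 ∎
  where
  open ≡-Reasoning
  module S = NatSolver.+-*-Solver

triangle-+ : ∀ k i → triangle (k ℕ.+ i) ≡ triangle i ℕ.+ k ℕ.* i ℕ.+ triangle k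
triangle-+ zero    i = S.solve 1 (λ t → t S.:= t S.:+ S.con 0 S.:+ S.con 0) refl (triangle i)
  where module S = NatSolver.+-*-Solver
triangle-+ (suc k) i = trans (cong (ℕ._+ suc (k ℕ.+ i)) (triangle-+ k i))
  (S.solve 4 (λ t s k i → t S.:+ k S.:* i S.:+ s S.:+ (S.con 1 S.:+ (k S.:+ i))
    S.:= t S.:+ (i S.:+ k S.:* i) S.:+ (s S.:+ (S.con 1 S.:+ k))) refl (triangle i) (triangle k) k i)
  where module S = NatSolver.+-*-Solver

-- `triangle i` comes from `τ (suc i)`, and `k * i` from the power `z^i` in `Sum-telescope` at
-- `z = q^k`.
V-exponent : ∀ k i → ((k ℕ.+ i) ℕ.* suc (k ℕ.+ i)) / 2 ∸ (k ℕ.* suc k) / 2 ≡ triangle i ℕ.+ k ℕ.* i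
V-exponent k i = begin
  ((k ℕ.+ i) ℕ.* suc (k ℕ.+ i)) / 2 ∸ (k ℕ.* suc k) / 2    ≡⟨ cong₂ _∸_ (half (k ℕ.+ i)) (half k) ⟩
  triangle (k ℕ.+ i) ∸ triangle k                          ≡⟨ cong (_∸ triangle k) (triangle-+ k i) ⟩
  triangle i ℕ.+ k ℕ.* i ℕ.+ triangle k ∸ triangle k       ≡⟨ ℕₚ.m+n∸n≡m (triangle i ℕ.+ k ℕ.* i) (triangle k) ⟩
  triangle i ℕ.+ k ℕ.* i                                   ∎
  where
  open ≡-Reasoning
  half : ∀ n → (n ℕ.* suc n) / 2 ≡ triangle n
  half n = trans (cong (_/ 2) (n[n+1]≡2triangle n)) (DivMod.m*n/n≡m (triangle n) 2)

-- For `p = q²` the first summand is the exponent of `τ (suc i)` and the second that of `y_i^k`,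
-- since `y_i = q^(2i+1)`.
W-exponent : ∀ k i → (k ℕ.+ i) ℕ.* suc (k ℕ.+ i) ∸ k ℕ.* k ≡ 2 ℕ.* triangle i ℕ.+ (2 ℕ.* i ℕ.+ 1) ℕ.* k
W-exponent k i = begin
  (k ℕ.+ i) ℕ.* suc (k ℕ.+ i) ∸ k ℕ.* k
    ≡⟨ cong (_∸ k ℕ.* k) (S.solve 2 (λ k i → (k S.:+ i) S.:* (S.con 1 S.:+ (k S.:+ i))
         S.:= i S.:* (S.con 1 S.:+ i) S.:+ (S.con 2 S.:* i S.:+ S.con 1) S.:* k S.:+ k S.:* k) refl k i) ⟩
  i ℕ.* suc i ℕ.+ (2 ℕ.* i ℕ.+ 1) ℕ.* k ℕ.+ k ℕ.* k ∸ k ℕ.* k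
    ≡⟨ ℕₚ.m+n∸n≡m (i ℕ.* suc i ℕ.+ (2 ℕ.* i ℕ.+ 1) ℕ.* k) (k ℕ.* k) ⟩
  i ℕ.* suc i ℕ.+ (2 ℕ.* i ℕ.+ 1) ℕ.* k
    ≡⟨ cong (ℕ._+ (2 ℕ.* i ℕ.+ 1) ℕ.* k) (trans (n[n+1]≡2triangle i) (ℕₚ.*-comm (triangle i) 2)) ⟩
  2 ℕ.* triangle i ℕ.+ (2 ℕ.* i ℕ.+ 1) ℕ.* k ∎
  where
  open ≡-Reasoning
  module S = NatSolver.+-*-Solver

triangle-≥ : ∀ i → i ℕ.≤ triangle i
triangle-≥ zero    = z≤n
triangle-≥ (suc i) = ℕₚ.m≤n+m (suc i) (triangle i)

sg≈const : ∀ i → sg i ≈ const ((ℤ.- + 1) ℤ.^ i)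
sg≈const zero    = ≈-refl
sg≈const (suc i) = ≈-trans (mk≈ λ n → cong ℤ.-_ (at (sg≈const i) n))
  (≈-trans (≈-sym (const-neg ((ℤ.- + 1) ℤ.^ i))) (≡⇒≈ (cong const (sym (ℤₚ.-1*i≡-i ((ℤ.- + 1) ℤ.^ i))))))

triangularPower-X^ : ∀ d i → triangularPower (X^ d ^ₚ_) (suc i) ≈ X^ (d ℕ.* triangle i)
triangularPower-X^ d zero    = ≈-trans (identityˡ 1ₚ) (≈-trans (≈-sym X^0≈1) (≡⇒≈ (cong X^ (sym (ℕₚ.*-zeroʳ d)))))
triangularPower-X^ d (suc i) = ≈-trans
  (*ₚ-cong (triangularPower (X^ d ^ₚ_) (suc i)) (X^ d ^ₚ suc i) (X^ (d ℕ.* triangle i)) (X^ (d ℕ.* suc i))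
    (triangularPower-X^ d i) (X^-^ d (suc i)))
  (≈-trans (≈-sym (X^-+ (d ℕ.* triangle i) (d ℕ.* suc i)))
    (≡⇒≈ (cong X^ (sym (ℕₚ.*-distribˡ-+ d (triangle i) (suc i))))))

X^-node : ∀ d M → X^ d ^ₚ M *ₚ X ≈ X^ (d ℕ.* M ℕ.+ 1)
X^-node d M = ≈-trans (*ₚ-congʳ (X^ d ^ₚ M) (X^ (d ℕ.* M)) X (X^-^ d M)) (≈-sym (X^-+ (d ℕ.* M) 1))

^ₚ-cong : ∀ a b n → a ≈ b → a ^ₚ n ≈ b ^ₚ n
^ₚ-cong a b zero    e = ≈-refl
^ₚ-cong a b (suc n) e = *ₚ-cong a (a ^ₚ n) b (b ^ₚ n) e (^ₚ-cong a b n e)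

X^-node-^ : ∀ d i k → (X^ d ^ₚ i *ₚ X) ^ₚ k ≈ X^ ((d ℕ.* i ℕ.+ 1) ℕ.* k)
X^-node-^ d i k = ≈-trans (^ₚ-cong (X^ d ^ₚ i *ₚ X) (X^ (d ℕ.* i ℕ.+ 1)) k (X^-node d i)) (X^-^ (d ℕ.* i ℕ.+ 1) k)

scale-vanish : ∀ {N} c a → a ≈[ N ] 0ₚ → scale c a ≈[ N ] 0ₚ
scale-vanish c a e = ≈[]-trans (≈⇒≈[] _ (scale≈const* c a)) (*-vanishʳ (const c) a e)

-- `Vterm ε n` and `Wterm ε n` are definitionally its values at `n` and `2 * n ∸ 1`.
chainTerm : ℤ → ℕ → PS
chainTerm ε e = X^ e *ₚ recip ((1ₚ -ₚ scale ε (X^ e)) ^ₚ 2)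

chainTerm-vanish : ∀ ε {N e} → N ℕ.≤ e → chainTerm ε e ≈[ N ] 0ₚ
chainTerm-vanish ε {N} {e} N≤e = *-vanishˡ (X^ e) (recip ((1ₚ -ₚ scale ε (X^ e)) ^ₚ 2)) (≈[]-mono N≤e (X^-vanish e))

chainTerm-clear : ∀ ε e z → z ≈ X^ (suc e) →
  (1ₚ -ₚ const ε *ₚ z) *ₚ (1ₚ -ₚ const ε *ₚ z) *ₚ chainTerm ε (suc e) ≈ z
chainTerm-clear ε e z z≈ = ≈-trans
  (*ₚ-congʳ (v *ₚ v) (u *ₚ u) (chainTerm ε (suc e)) (*ₚ-cong v v u u v≈u v≈u))
  (≈-trans (solve 3 (λ u x r → u :* u :* (x :* r) := x :* (u :* (u :* con (+ 1)) :* r)) ≈-refl u x (recip (u ^ₚ 2)))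
  (≈-trans (*ₚ-congˡ x (u ^ₚ 2 *ₚ recip (u ^ₚ 2)) 1ₚ (recip-inverse (u ^ₚ 2) (*ₚ-at0 u (u ^ₚ 1) u0 (*ₚ-at0 u 1ₚ u0 refl))))
  (≈-trans (CommutativeRing.*-identityʳ powerSeriesRing x) (≈-sym z≈))))
  where
  x = X^ (suc e)
  u = 1ₚ -ₚ scale ε x
  v = 1ₚ -ₚ const ε *ₚ z
  u0 : u 0 ≡ + 1
  u0 = 1-ₚ-at0 (scale ε x) (ℤₚ.*-zeroʳ ε)
  v≈u : v ≈ u
  v≈u = mk≈ λ n → cong (λ t → 1ₚ n ℤ.- t) (at (≈-trans (*ₚ-congˡ (const ε) z x z≈) (≈-sym (scale≈const* ε x))) n)

sgn² : ∀ s → sgn s ℤ.* sgn s ≡ + 1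
sgn² Sign.+ = refl
sgn² Sign.- = refl

-- The two identities

module _ (s : Sign) (k : ℕ) where

  wV : ℕ → PS
  wV i = 1ₚ -ₚ X ^ₚ suc i

  module LV = Limit X refl 2 (≈-sym (*ₚ-congˡ X (X *ₚ 1ₚ) X (CommutativeRing.*-identityʳ powerSeriesRing X)))
    wV
    (≈-trans (≈-sym (recipPoch-step X refl 1)) (recipPoch-one X refl))
    (λ i → ≈-trans (*ₚ-comm (wV i) (wV (suc i)))
      (*ₚ-congʳ (wV (suc i)) (1ₚ -ₚ X ^ₚ (i ℕ.+ 2)) (wV i) (≡⇒≈ (cong (λ z → 1ₚ -ₚ X ^ₚ z) (ℕₚ.+-comm 2 i)))))
    (sgn s) (sgn² s) (Vterm (sgn s))
    (λ m → chainTerm-vanish (sgn s) ℕₚ.≤-refl)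
    (λ M → chainTerm-clear (sgn s) M (X ^ₚ M *ₚ X)
      (≈-trans (X^-node 1 M) (≡⇒≈ (cong X^ (trans (ℕₚ.+-comm (1 ℕ.* M) 1) (cong suc (ℕₚ.*-identityˡ M)))))))

  V-summand : ℕ → PS
  V-summand i = scale ((ℤ.- + 1) ℤ.^ i) (X^ (((k ℕ.+ i) ℕ.* suc (k ℕ.+ i)) / 2 ∸ (k ℕ.* suc k) / 2))

  V-summand-vanish : ∀ i → V-summand i ≈[ i ] 0ₚ
  V-summand-vanish i = scale-vanish ((ℤ.- + 1) ℤ.^ i) (X^ _)
    (≈[]-mono (ℕₚ.≤-trans (ℕₚ.≤-trans (triangle-≥ i) (ℕₚ.m≤m+n (triangle i) (k ℕ.* i))) (ℕₚ.≤-reflexive (sym (V-exponent k i))))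
      (X^-vanish _))

  V-summand≈ : ∀ i → V-summand i ≈ sg i *ₚ LV.τ (suc i) *ₚ X^ k ^ i
  V-summand≈ i rewrite V-exponent k i | ^≡^ₚ (X^ k) i = ≈-trans
    (scale≈const* ((ℤ.- + 1) ℤ.^ i) (X^ (triangle i ℕ.+ k ℕ.* i)))
    (≈-trans (*ₚ-cong (const ((ℤ.- + 1) ℤ.^ i)) (X^ (triangle i ℕ.+ k ℕ.* i)) (sg i) (t *ₚ X^ k ^ₚ i) (≈-sym (sg≈const i))
        (≈-trans (X^-+ (triangle i) (k ℕ.* i))
          (*ₚ-cong (X^ (triangle i)) (X^ (k ℕ.* i)) t (X^ k ^ₚ i)
            (≈-sym (≈-trans (triangularPower-X^ 1 i) (≡⇒≈ (cong X^ (ℕₚ.*-identityˡ (triangle i))))))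
            (≈-sym (X^-^ k i)))))
      (solve 3 (λ a b c → a :* (b :* c) := a :* b :* c) ≈-refl (sg i) t (X^ k ^ₚ i)))
    where t = LV.τ (suc i)

  V-series : ∀ i → LV.series k i ≈ sg i *ₚ LV.τ (suc i) *ₚ (1ₚ -ₚ X ^ₚ suc i) *ₚ X^ k ^ suc i
  V-series i = *ₚ-congˡ (LV.g i) (LV.y i ^ₚ k) (X^ k ^ suc i)
    (≈-trans (X^-node-^ 1 i k) (≈-trans (≡⇒≈ (cong X^ exponent))
      (≈-trans (≈-sym (X^-^ k (suc i))) (≡⇒≈ (sym (^≡^ₚ (X^ k) (suc i)))))))
    where
    exponent : (1 ℕ.* i ℕ.+ 1) ℕ.* k ≡ k ℕ.* suc i
    exponent = trans (cong (ℕ._* k) (trans (ℕₚ.+-comm (1 ℕ.* i) 1) (cong suc (ℕₚ.*-identityˡ i)))) (ℕₚ.*-comm (suc i) k)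

  V-bracket : PS
  V-bracket = const (ℤ.- + 1) +ₚ (1ₚ +ₚ X^ k) *ₚ qsum V-summand

  V-bracket≈ : ∀ N m → N ℕ.≤ m → Sum m (LV.series k) ≈[ N ] V-bracket
  V-bracket≈ N m N≤m = ≈[]-trans (≈⇒≈[] N (≈-trans (Sum-cong m (λ i _ → V-series i)) (LV.Sum-telescope (X^ k) m)))
    (≈[]-trans
      (+-cong[] (-ₚ 1ₚ +ₚ (1ₚ +ₚ X^ k) *ₚ S) ρ V-bracket 0ₚ
        (+-cong[] (-ₚ 1ₚ) ((1ₚ +ₚ X^ k) *ₚ S) (const (ℤ.- + 1)) ((1ₚ +ₚ X^ k) *ₚ qsum V-summand)
          (≈⇒≈[] N (≈-sym (const-neg (+ 1))))
          (*-congˡ[] (1ₚ +ₚ X^ k) S (qsum V-summand)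
            (≈[]-sym (≈[]-trans (qsum≈Sum V-summand V-summand-vanish N≤m) (≈⇒≈[] N (Sum-cong m (λ i _ → V-summand≈ i)))))))
        -- The end term of the telescoping is divisible by `q^m`, the last factor of `τ (suc m)`.
        (*-vanishˡ (sg m *ₚ LV.τ (suc m)) (X^ k ^ m) (*-vanishʳ (sg m) (LV.τ (suc m))
          (*-vanishʳ (LV.τ m) (X ^ₚ m) (≈[]-mono N≤m (^-vanish X refl m))))))
      (≈⇒≈[] N (CommutativeRing.+-identityʳ powerSeriesRing V-bracket)))
    where
    S = Sum m (λ i → sg i *ₚ LV.τ (suc i) *ₚ X^ k ^ i)
    ρ = sg m *ₚ LV.τ (suc m) *ₚ X^ k ^ m

  V-identity : ∀ N → LV.transform k N ≡ (LV.P∞ ^ₚ 2 *ₚ recip (LV.Q∞ ^ₚ 2) *ₚ V-bracket) N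
  V-identity N = at< (≈[]-trans (LV.transform-limit k (suc N))
    (*-congˡ[] (LV.P∞ ^ₚ 2 *ₚ recip (LV.Q∞ ^ₚ 2)) (Sum m (LV.series k)) V-bracket
      (V-bracket≈ (suc N) m (ℕₚ.m≤n⇒m≤1+n (ℕₚ.m≤m+n (suc N) (suc N)))))) N ℕₚ.≤-refl
    where m = suc (suc N ℕ.+ suc N)

  wW : ℕ → PS
  wW _ = 1ₚ

  module LW = Limit (X^ 2) refl 1
    (≈-trans (≈-sym (X^-+ 1 1)) (≈-sym (CommutativeRing.*-identityʳ powerSeriesRing (X^ 2))))
    wW
    (≈-trans (identityˡ (recipPoch (X^ 2) 1)) (recipPoch-one (X^ 2) refl))
    (λ i → *ₚ-congʳ (1ₚ -ₚ X^ 2 ^ₚ suc i) (1ₚ -ₚ X^ 2 ^ₚ (i ℕ.+ 1)) 1ₚ (≡⇒≈ (cong (λ z → 1ₚ -ₚ X^ 2 ^ₚ z) (ℕₚ.+-comm 1 i))))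
    (sgn s) (sgn² s) (Wterm (sgn s))
    (λ m → chainTerm-vanish (sgn s) (ℕₚ.≤-trans (ℕₚ.m≤n+m (suc m) m) (ℕₚ.≤-reflexive (cong (λ z → m ℕ.+ suc z) (sym (ℕₚ.+-identityʳ m))))))
    -- `2 * suc M ∸ 1` computes to `M + suc (M + 0)`, which is not yet a successor as
    -- `chainTerm-clear` demands.
    (λ M → subst (λ e → (1ₚ -ₚ const (sgn s) *ₚ (X^ 2 ^ₚ M *ₚ X)) *ₚ (1ₚ -ₚ const (sgn s) *ₚ (X^ 2 ^ₚ M *ₚ X)) *ₚ chainTerm (sgn s) e ≈ X^ 2 ^ₚ M *ₚ X)
      (sym (ℕₚ.+-suc M (M ℕ.+ 0)))
      (chainTerm-clear (sgn s) (2 ℕ.* M) (X^ 2 ^ₚ M *ₚ X) (≈-trans (X^-node 2 M) (≡⇒≈ (cong X^ (ℕₚ.+-comm (2 ℕ.* M) 1))))))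

  W-summand : ℕ → PS
  W-summand i = scale ((ℤ.- + 1) ℤ.^ i) (X^ ((k ℕ.+ i) ℕ.* suc (k ℕ.+ i) ∸ k ℕ.* k))

  W-summand-vanish : ∀ i → W-summand i ≈[ i ] 0ₚ
  W-summand-vanish i = scale-vanish ((ℤ.- + 1) ℤ.^ i) (X^ _)
    (≈[]-mono (ℕₚ.≤-trans (ℕₚ.≤-trans (triangle-≥ i) (ℕₚ.≤-trans (ℕₚ.m≤m+n (triangle i) _) (ℕₚ.m≤m+n (2 ℕ.* triangle i) _)))
        (ℕₚ.≤-reflexive (sym (W-exponent k i))))
      (X^-vanish _))

  W-series : ∀ i → LW.series k i ≈ W-summand i
  W-series i rewrite W-exponent k i = ≈-trans
    (solve 3 (λ a b c → a :* b :* con (+ 1) :* c := a :* (b :* c)) ≈-refl (sg i) t (LW.y i ^ₚ k))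
    (≈-trans (*ₚ-cong (sg i) (t *ₚ LW.y i ^ₚ k) (const ((ℤ.- + 1) ℤ.^ i)) (X^ (2 ℕ.* triangle i ℕ.+ (2 ℕ.* i ℕ.+ 1) ℕ.* k)) (sg≈const i)
      (≈-trans (*ₚ-cong t (LW.y i ^ₚ k) (X^ (2 ℕ.* triangle i)) (X^ ((2 ℕ.* i ℕ.+ 1) ℕ.* k)) (triangularPower-X^ 2 i) (X^-node-^ 2 i k))
        (≈-sym (X^-+ (2 ℕ.* triangle i) ((2 ℕ.* i ℕ.+ 1) ℕ.* k)))))
      (≈-sym (scale≈const* ((ℤ.- + 1) ℤ.^ i) (X^ (2 ℕ.* triangle i ℕ.+ (2 ℕ.* i ℕ.+ 1) ℕ.* k)))))
    where t = LW.τ (suc i)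

  W-identity : ∀ N → LW.transform k N ≡ (LW.P∞ ^ₚ 2 *ₚ recip (LW.Q∞ ^ₚ 2) *ₚ qsum W-summand) N
  W-identity N = at< (≈[]-trans (LW.transform-limit k (suc N))
    (*-congˡ[] (LW.P∞ ^ₚ 2 *ₚ recip (LW.Q∞ ^ₚ 2)) (Sum m (LW.series k)) (qsum W-summand)
      (≈[]-trans (≈⇒≈[] (suc N) (Sum-cong m (λ i _ → W-series i)))
        (≈[]-sym (qsum≈Sum W-summand W-summand-vanish (ℕₚ.m≤n⇒m≤1+n (ℕₚ.m≤m+n (suc N) (suc N)))))))) N ℕₚ.≤-refl
    where m = suc (suc N ℕ.+ suc N)

theorem3 : (s : Sign) (k : ℕ) →
    ((N : ℕ) →
    qsum (λ i → scale ((ℤ.- sgn s) ℤ.^ i ℤ.* + ((2 ℕ.* (k ℕ.+ i)) C i)) (V s (k ℕ.+ i))) N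
    ≡ ((pochInf (scale (sgn s) X) X ^ₚ 2) *ₚ recip (pochInf X X ^ₚ 2)
    *ₚ (const (ℤ.- + 1) +ₚ (1ₚ +ₚ X^ k)
    *ₚ qsum (λ i → scale ((ℤ.- + 1) ℤ.^ i)
    (X^ (((k ℕ.+ i) ℕ.* suc (k ℕ.+ i)) / 2 ∸ (k ℕ.* suc k) / 2))))) N)
    ×
    ((N : ℕ) →
    qsum (λ i → scale ((ℤ.- sgn s) ℤ.^ i ℤ.* + ((2 ℕ.* (k ℕ.+ i)) C i)) (W s (k ℕ.+ i))) N
    ≡ ((pochInf (scale (sgn s) X) (X^ 2) ^ₚ 2) *ₚ recip (pochInf (X^ 2) (X^ 2) ^ₚ 2)
    *ₚ qsum (λ i → scale ((ℤ.- + 1) ℤ.^ i)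
    (X^ ((k ℕ.+ i) ℕ.* suc (k ℕ.+ i) ∸ k ℕ.* k)))) N)
theorem3 s k = V-identity s k , W-identity s k
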